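{- For all positive integers $b$ and $w$, the limit $$s_{b\times w}=\lim_{n\to\infty}\frac{\log(T_{b\times w}(n))}{n}$$ exists (as a finite real number).
   Context: Let $b,w$ be positive integers. A $b\times w$ block is a subset of $\mathbb{R}^3$ of the form $[x,x+b]\times[y,y+w]\times[z,z+1]$ or $[x,x+w]\times[y,y+b]\times[z,z+1]$ with $x,y,z\in\mathbb{Z}$. A building is a finite set of blocks with pairwise disjoint interiors. Two blocks of a building are attached if their $z$-coordinates differ by exactly $1$ and their projections to the $xy$-plane overlap in a set with nonempty interior (i.e. at least one stud of the lower block is inserted into the upper block). A building is contiguous if the graph on its blocks given by attachment is connected. Two buildings are identified if one is mapped onto the other by a composition of translations of $\mathbb{R}^3$ and rotations about vertical axes (rotations in the $xy$-plane, by multiples of $90^\circ$). $T_{b\times w}(n)$ denotes the number of contiguous buildings consisting of exactly $n$ blocks of dimension $b\times w$, counted up to this identification. -}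

module Defs where

open import Data.Fin.Base using (Fin)
open import Data.Integer.Base as ℤ using (ℤ; +_; 0ℤ; 1ℤ)
import Data.Integer.Properties as ℤ
open import Data.Integer.Tactic.RingSolver using (solve-∀)
open import Data.List.Base using (List; map; length)
open import Data.List.Membership.Propositional using (_∈_)
open import Data.List.Properties using (map-∘; map-cong; map-id)
open import Data.List.Relation.Binary.BagAndSetEquality
  using (_∼[_]_; set; [_]-Equality) renaming (map-cong to ∼-map-cong)
open import Data.List.Relation.Unary.All using (All)
open import Data.List.Relation.Unary.AllPairs using (AllPairs)
open import Data.Nat.Base as ℕ using (ℕ; zero; suc; NonZero)
open import Data.Nat.GeneralisedArithmetic using (fold)
import Data.Nat.Properties as ℕ
open import Data.Product.Base using (∃-syntax; _×_; _,_; proj₁; proj₂)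
open import Data.Rational.Base as ℚ using (ℚ; 0ℚ; 1ℚ; ½)
import Data.Rational.Properties as ℚ
import Data.Rational.Unnormalised.Base as ℚᵘ
import Data.Rational.Unnormalised.Properties as ℚᵘ
open import Data.Rational.Solver using (module +-*-Solver)
open import Data.Sum.Base using (_⊎_; inj₁; inj₂)
open import Function.Base using (id; _∘_)
open import Function.Bundles using (Bijection)
open import Level using (0ℓ)
open import Relation.Binary.Bundles using (Setoid)
open import Relation.Binary.Construct.Closure.ReflexiveTransitive using (Star)
open import Relation.Binary.PropositionalEquality as ≡
  using (_≡_; refl; sym; trans; cong; cong₂; subst; subst₂; module ≡-Reasoning)
open import Relation.Nullary.Negation.Core using (¬_)

-- box x y z dx dy stands for [x, x+dx] × [y, y+dy] × [z, z+1].  It records the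
-- subset of space rather than an orientation, so a square block (b ≡ w) is not
-- counted twice.
record Box : Set where
  constructor box
  field
    x y z : ℤ
    dx dy : ℕ

open Box public

IsBlock : (b w : ℕ) → Box → Set
IsBlock b w A = (dx A ≡ b × dy A ≡ w) ⊎ (dx A ≡ w × dy A ≡ b)

-- The open intervals (p, p+m) and (q, q+n), with m and n positive, intersect.
IntervalsMeet : ℤ → ℕ → ℤ → ℕ → Set
IntervalsMeet p m q n = p ℤ.< q ℤ.+ + n × q ℤ.< p ℤ.+ + m

ProjectionsMeet : Box → Box → Set
ProjectionsMeet A B =
  IntervalsMeet (x A) (dx A) (x B) (dx B) × IntervalsMeet (y A) (dy A) (y B) (dy B)

InteriorsDisjoint : Box → Box → Set
InteriorsDisjoint A B = ¬ (ProjectionsMeet A B × IntervalsMeet (z A) 1 (z B) 1)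

Attached : Box → Box → Set
Attached A B = (z B ≡ z A ℤ.+ 1ℤ ⊎ z A ≡ z B ℤ.+ 1ℤ) × ProjectionsMeet A B

Contiguous : List Box → Set
Contiguous X = ∀ {A B} → A ∈ X → B ∈ X →
  Star (λ C D → C ∈ X × D ∈ X × Attached C D) A B

-- For positive b and w, pairwise disjoint interiors force the listed blocks to
-- be distinct, so length is the number of blocks.
record Building (b w n : ℕ) : Set where
  field
    blocks     : List Box
    size       : length blocks ≡ n
    areBlocks  : All (IsBlock b w) blocks
    disjoint   : AllPairs InteriorsDisjoint blocks
    contiguous : Contiguous blocks

open Building public

Vector : Set
Vector = ℤ × ℤ × ℤ

translate : Vector → Box → Box
translate (a , b , c) (box x y z dx dy) = box (x ℤ.+ a) (y ℤ.+ b) (z ℤ.+ c) dx dy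

-- The image of a box under the quarter turn (x , y , z) ↦ (- y , x , z).
rotate : Box → Box
rotate (box x y z dx dy) = box (ℤ.- (y ℤ.+ + dy)) x z dy dx

turn : ℕ → Box → Box
turn k A = fold A rotate k

-- Every composition of translations and of rotations by multiples of 90° about
-- vertical axes (anywhere) is k quarter turns about the z-axis followed by one
-- translation; if it maps a nonempty building to a building, that translation is
-- integral.
move : ℕ → Vector → Box → Box
move k v A = translate v (turn k A)

-- Lists are compared as sets: the order of the blocks is irrelevant.
Identified : List Box → List Box → Set
Identified X Y = ∃[ k ] ∃[ v ] (map (move k v) X ∼[ set ] Y)

private
  box-cong : ∀ {x x′ y y′ z z′ m n} → x ≡ x′ → y ≡ y′ → z ≡ z′ →
             box x y z m n ≡ box x′ y′ z′ m n
  box-cong refl refl refl = refl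

  rotateᵛ : Vector → Vector
  rotateᵛ (a , b , c) = ℤ.- b , a , c

  turnᵛ : ℕ → Vector → Vector
  turnᵛ k v = fold v rotateᵛ k

  _⊕_ : Vector → Vector → Vector
  (a , b , c) ⊕ (a′ , b′ , c′) = a ℤ.+ a′ , b ℤ.+ b′ , c ℤ.+ c′

  ⊖_ : Vector → Vector
  ⊖ (a , b , c) = ℤ.- a , ℤ.- b , ℤ.- c

  translate-⊕ : ∀ u v A → translate u (translate v A) ≡ translate (v ⊕ u) A
  translate-⊕ (a , b , c) (a′ , b′ , c′) (box x y z _ _) =
    box-cong (ℤ.+-assoc x a′ a) (ℤ.+-assoc y b′ b) (ℤ.+-assoc z c′ c)

  translate-0 : ∀ A → translate (0ℤ , 0ℤ , 0ℤ) A ≡ A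
  translate-0 (box x y z _ _) =
    box-cong (ℤ.+-identityʳ x) (ℤ.+-identityʳ y) (ℤ.+-identityʳ z)

  ⊕-inverse : ∀ v → v ⊕ (⊖ v) ≡ (0ℤ , 0ℤ , 0ℤ)
  ⊕-inverse (a , b , c) =
    cong₂ _,_ (ℤ.+-inverseʳ a) (cong₂ _,_ (ℤ.+-inverseʳ b) (ℤ.+-inverseʳ c))

  rotate-translate : ∀ v A → rotate (translate v A) ≡ translate (rotateᵛ v) (rotate A)
  rotate-translate (a , b , c) (box x y z dx dy) = box-cong (lemma y b (+ dy)) refl refl
    where
    lemma : ∀ p q r → ℤ.- ((p ℤ.+ q) ℤ.+ r) ≡ ℤ.- (p ℤ.+ r) ℤ.+ ℤ.- q
    lemma = solve-∀

  turn-translate : ∀ k v A → turn k (translate v A) ≡ translate (turnᵛ k v) (turn k A)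
  turn-translate zero    v A = refl
  turn-translate (suc k) v A =
    trans (cong rotate (turn-translate k v A)) (rotate-translate (turnᵛ k v) (turn k A))

  turn-+ : ∀ j k A → turn j (turn k A) ≡ turn (j ℕ.+ k) A
  turn-+ zero    k A = refl
  turn-+ (suc j) k A = cong rotate (turn-+ j k A)

  turn-4 : ∀ A → turn 4 A ≡ A
  turn-4 (box x y z dx dy) = box-cong (lemma x (+ dx)) (lemma y (+ dy)) refl
    where
    lemma : ∀ p q → ℤ.- (ℤ.- (p ℤ.+ q) ℤ.+ q) ≡ p
    lemma = solve-∀

  turn-4* : ∀ k A → turn (k ℕ.* 4) A ≡ A
  turn-4* zero    A = refl
  turn-4* (suc k) A = trans (turn-4 (turn (k ℕ.* 4) A)) (turn-4* k A)

  move-∘ : ∀ j u k v A → move j u (move k v A) ≡ move (j ℕ.+ k) (turnᵛ j v ⊕ u) A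
  move-∘ j u k v A = begin
    translate u (turn j (translate v (turn k A)))           ≡⟨ cong (translate u) (turn-translate j v (turn k A)) ⟩
    translate u (translate (turnᵛ j v) (turn j (turn k A))) ≡⟨ translate-⊕ u (turnᵛ j v) (turn j (turn k A)) ⟩
    translate (turnᵛ j v ⊕ u) (turn j (turn k A))           ≡⟨ cong (translate (turnᵛ j v ⊕ u)) (turn-+ j k A) ⟩
    translate (turnᵛ j v ⊕ u) (turn (j ℕ.+ k) A)            ∎
    where open ≡-Reasoning

  move-inverse : ∀ k v A → move (k ℕ.* 3) (⊖ turnᵛ (k ℕ.* 3) v) (move k v A) ≡ A
  move-inverse k v A = begin
    move (k ℕ.* 3) (⊖ u) (move k v A)                ≡⟨ move-∘ (k ℕ.* 3) (⊖ u) k v A ⟩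
    translate (u ⊕ (⊖ u)) (turn (k ℕ.* 3 ℕ.+ k) A)   ≡⟨ cong₂ (λ t n → translate t (turn n A)) (⊕-inverse u) k*3+k≡k*4 ⟩
    translate (0ℤ , 0ℤ , 0ℤ) (turn (k ℕ.* 4) A)      ≡⟨ translate-0 _ ⟩
    turn (k ℕ.* 4) A                                 ≡⟨ turn-4* k A ⟩
    A                                                ∎
    where
    open ≡-Reasoning
    u = turnᵛ (k ℕ.* 3) v
    k*3+k≡k*4 : k ℕ.* 3 ℕ.+ k ≡ k ℕ.* 4
    k*3+k≡k*4 = trans (ℕ.+-comm (k ℕ.* 3) k) (sym (ℕ.*-suc k 3))

  module ∼ = Setoid ([ set ]-Equality Box)

  Identified-refl : ∀ {X} → Identified X X
  Identified-refl {X} = 0 , (0ℤ , 0ℤ , 0ℤ) ,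
    ∼.reflexive (trans (map-cong translate-0 X) (map-id X))

  Identified-sym : ∀ {X Y} → Identified X Y → Identified Y X
  Identified-sym {X} {Y} (k , v , X∼Y) = k ℕ.* 3 , ⊖ turnᵛ (k ℕ.* 3) v , ∼.trans
    (∼.sym (∼-map-cong (λ _ → refl) X∼Y))
    (∼.reflexive (trans (sym (map-∘ X)) (trans (map-cong (move-inverse k v) X) (map-id X))))

  Identified-trans : ∀ {X Y Z} → Identified X Y → Identified Y Z → Identified X Z
  Identified-trans {X} {Y} {Z} (k , v , X∼Y) (j , u , Y∼Z) =
    j ℕ.+ k , turnᵛ j v ⊕ u , ∼.trans
      (∼.reflexive (trans (sym (map-cong (move-∘ j u k v) X)) (map-∘ X)))
      (∼.trans (∼-map-cong (λ _ → refl) X∼Y) Y∼Z)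

buildings : (b w n : ℕ) → Setoid 0ℓ 0ℓ
buildings b w n = record
  { Carrier       = Building b w n
  ; _≈_           = λ X Y → Identified (blocks X) (blocks Y)
  ; isEquivalence = record
    { refl  = Identified-refl
    ; sym   = Identified-sym
    ; trans = Identified-trans
    }
  }

HasCardinality : Setoid 0ℓ 0ℓ → ℕ → Set
HasCardinality S k = Bijection (≡.setoid (Fin k)) S

-- Equality of reals is not needed: a real enters only through _-_, ∣_∣, _÷_ and _<_.
record ℝ : Set where
  constructor real
  field
    seq    : ℕ → ℚ
    cauchy : ∀ ε → 0ℚ ℚ.< ε →
             ∃[ N ] (∀ m n → N ℕ.≤ m → N ℕ.≤ n → ℚ.∣ seq m ℚ.- seq n ∣ ℚ.< ε)

open ℝ public

private
  half-pos : ∀ {ε} → 0ℚ ℚ.< ε → 0ℚ ℚ.< ½ ℚ.* ε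
  half-pos {ε} 0<ε = subst (ℚ._< ½ ℚ.* ε) (ℚ.*-zeroʳ ½) (ℚ.*-monoʳ-<-pos ½ 0<ε)

  halves : ∀ ε → ½ ℚ.* ε ℚ.+ ½ ℚ.* ε ≡ ε
  halves ε = trans (sym (ℚ.*-distribʳ-+ ε ½ ½)) (ℚ.*-identityˡ ε)

  p-p≡0 : ∀ p → p ℚ.- p ≡ 0ℚ
  p-p≡0 = ℚ.+-inverseʳ

  ∣p-q∣-sym : ∀ p q → ℚ.∣ p ℚ.- q ∣ ≡ ℚ.∣ q ℚ.- p ∣
  ∣p-q∣-sym p q = trans (sym (ℚ.∣-p∣≡∣p∣ (p ℚ.- q))) (cong ℚ.∣_∣ (lemma p q))
    where
    open +-*-Solver
    lemma : ∀ p q → ℚ.- (p ℚ.- q) ≡ q ℚ.- p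
    lemma = solve 2 (λ p q → :- (p :- q) := q :- p) refl

  p≡q+[p-q] : ∀ p q → p ≡ q ℚ.+ (p ℚ.- q)
  p≡q+[p-q] = solve 2 (λ p q → p := q :+ (p :- q)) refl
    where open +-*-Solver

  p≤∣p∣ : ∀ p → p ℚ.≤ ℚ.∣ p ∣
  p≤∣p∣ p with ℚ.≤-total 0ℚ p
  ... | inj₁ 0≤p = ℚ.≤-reflexive (sym (ℚ.0≤p⇒∣p∣≡p 0≤p))
  ... | inj₂ p≤0 = ℚ.≤-trans p≤0 (ℚ.0≤∣p∣ p)

  ∣∣-lub : ∀ {p r} → p ℚ.≤ r → ℚ.- p ℚ.≤ r → ℚ.∣ p ∣ ℚ.≤ r
  ∣∣-lub {p} p≤r -p≤r with ℚ.∣p∣≡p∨∣p∣≡-p p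
  ... | inj₁ eq = subst (ℚ._≤ _) (sym eq) p≤r
  ... | inj₂ eq = subst (ℚ._≤ _) (sym eq) -p≤r

  p-q≤r : ∀ {p q r} → p ℚ.≤ q ℚ.+ r → p ℚ.- q ℚ.≤ r
  p-q≤r {p} {q} {r} p≤q+r = subst (p ℚ.- q ℚ.≤_) (lemma q r) (ℚ.+-monoˡ-≤ (ℚ.- q) p≤q+r)
    where
    open +-*-Solver
    lemma : ∀ q r → (q ℚ.+ r) ℚ.- q ≡ r
    lemma = solve 2 (λ q r → (q :+ r) :- q := r) refl

  ∣∣p∣-∣q∣∣≤∣p-q∣ : ∀ p q → ℚ.∣ ℚ.∣ p ∣ ℚ.- ℚ.∣ q ∣ ∣ ℚ.≤ ℚ.∣ p ℚ.- q ∣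
  ∣∣p∣-∣q∣∣≤∣p-q∣ p q = ∣∣-lub (triangle p q)
    (subst₂ ℚ._≤_ (lemma ℚ.∣ p ∣ ℚ.∣ q ∣) (∣p-q∣-sym q p) (triangle q p))
    where
    open +-*-Solver
    lemma : ∀ p q → q ℚ.- p ≡ ℚ.- (p ℚ.- q)
    lemma = solve 2 (λ p q → q :- p := :- (p :- q)) refl
    triangle : ∀ p q → ℚ.∣ p ∣ ℚ.- ℚ.∣ q ∣ ℚ.≤ ℚ.∣ p ℚ.- q ∣
    triangle p q = p-q≤r (subst (ℚ._≤ ℚ.∣ q ∣ ℚ.+ ℚ.∣ p ℚ.- q ∣)
      (cong ℚ.∣_∣ (sym (p≡q+[p-q] p q))) (ℚ.∣p+q∣≤∣p∣+∣q∣ q (p ℚ.- q)))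

infixl 6 _-_
infixl 7 _÷_
infix  4 _<_ _⟶_

fromℚ : ℚ → ℝ
fromℚ q = real (λ _ → q) λ ε 0<ε → 0 , λ _ _ _ _ →
  subst (λ p → ℚ.∣ p ∣ ℚ.< ε) (sym (p-p≡0 q)) 0<ε

_-_ : ℝ → ℝ → ℝ
r - s = real (λ k → seq r k ℚ.- seq s k) λ ε 0<ε →
  let M , M-ok = cauchy r (½ ℚ.* ε) (half-pos 0<ε)
      N , N-ok = cauchy s (½ ℚ.* ε) (half-pos 0<ε)
  in M ℕ.⊔ N , λ m n le le′ → begin-strict
    ℚ.∣ (seq r m ℚ.- seq s m) ℚ.- (seq r n ℚ.- seq s n) ∣        ≡⟨ cong ℚ.∣_∣ (lemma (seq r m) (seq s m) (seq r n) (seq s n)) ⟩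
    ℚ.∣ (seq r m ℚ.- seq r n) ℚ.+ (seq s n ℚ.- seq s m) ∣        ≤⟨ ℚ.∣p+q∣≤∣p∣+∣q∣ (seq r m ℚ.- seq r n) _ ⟩
    ℚ.∣ seq r m ℚ.- seq r n ∣ ℚ.+ ℚ.∣ seq s n ℚ.- seq s m ∣      <⟨ ℚ.+-mono-<
                                                                     (M-ok m n (ℕ.m⊔n≤o⇒m≤o M N le) (ℕ.m⊔n≤o⇒m≤o M N le′))
                                                                     (N-ok n m (ℕ.m⊔n≤o⇒n≤o M N le′) (ℕ.m⊔n≤o⇒n≤o M N le)) ⟩
    ½ ℚ.* ε ℚ.+ ½ ℚ.* ε                                          ≡⟨ halves ε ⟩
    ε                                                            ∎
  where
  open ℚ.≤-Reasoning
  open +-*-Solver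
  lemma : ∀ a b c d → (a ℚ.- b) ℚ.- (c ℚ.- d) ≡ (a ℚ.- c) ℚ.+ (d ℚ.- b)
  lemma = solve 4 (λ a b c d → (a :- b) :- (c :- d) := (a :- c) :+ (d :- b)) refl

∣_∣ : ℝ → ℝ
∣ r ∣ = real (λ k → ℚ.∣ seq r k ∣) λ ε 0<ε →
  let N , N-ok = cauchy r ε 0<ε
  in N , λ m n le le′ →
    ℚ.≤-<-trans (∣∣p∣-∣q∣∣≤∣p-q∣ (seq r m) (seq r n)) (N-ok m n le le′)

_<_ : ℝ → ℝ → Set
r < s = ∃[ δ ] (0ℚ ℚ.< δ × ∃[ N ] (∀ k → N ℕ.≤ k → seq r k ℚ.+ δ ℚ.≤ seq s k))

private
  fromℚᵘ-mono-≤ : ∀ {p q} → p ℚᵘ.≤ q → ℚ.fromℚᵘ p ℚ.≤ ℚ.fromℚᵘ q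
  fromℚᵘ-mono-≤ {p} {q} p≤q = ℚ.toℚᵘ-cancel-≤
    (ℚᵘ.≤-respˡ-≃ (ℚᵘ.≃-sym (ℚ.toℚᵘ-fromℚᵘ p)) (ℚᵘ.≤-respʳ-≃ (ℚᵘ.≃-sym (ℚ.toℚᵘ-fromℚᵘ q)) p≤q))

  fromℚᵘ-mono-< : ∀ {p q} → p ℚᵘ.< q → ℚ.fromℚᵘ p ℚ.< ℚ.fromℚᵘ q
  fromℚᵘ-mono-< {p} {q} p<q = ℚ.toℚᵘ-cancel-<
    (ℚᵘ.<-respˡ-≃ (ℚᵘ.≃-sym (ℚ.toℚᵘ-fromℚᵘ p)) (ℚᵘ.<-respʳ-≃ (ℚᵘ.≃-sym (ℚ.toℚᵘ-fromℚᵘ q)) p<q))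

  /-mono : ∀ a b m n .{{_ : NonZero m}} .{{_ : NonZero n}} →
           a ℕ.* n ℕ.≤ b ℕ.* m → (+ a ℚ./ m) ℚ.≤ (+ b ℚ./ n)
  /-mono a b (suc m) (suc n) le = fromℚᵘ-mono-≤ {ℚᵘ.mkℚᵘ (+ a) m} {ℚᵘ.mkℚᵘ (+ b) n}
    (ℚᵘ.*≤* (subst₂ ℤ._≤_ (ℤ.pos-* a (suc n)) (ℤ.pos-* b (suc m)) (ℤ.+≤+ le)))

  1/n≤1 : ∀ n .{{_ : NonZero n}} → (+ 1 ℚ./ n) ℚ.≤ 1ℚ
  1/n≤1 n = /-mono 1 1 n 1 (ℕ.+-monoˡ-≤ 0 (ℕ.>-nonZero⁻¹ n))

  0≤1/n : ∀ n .{{_ : NonZero n}} → ℚ.NonNegative (+ 1 ℚ./ n)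
  0≤1/n n = ℚ.normalize-nonNeg 1 n

_÷_ : ℝ → (n : ℕ) .{{_ : NonZero n}} → ℝ
r ÷ n = real (λ k → seq r k ℚ.* (+ 1 ℚ./ n)) λ ε 0<ε →
  let N , N-ok = cauchy r ε 0<ε
  in N , λ i j le le′ → let d = seq r i ℚ.- seq r j in begin-strict
    ℚ.∣ seq r i ℚ.* q ℚ.- seq r j ℚ.* q ∣ ≡⟨ cong ℚ.∣_∣ (lemma (seq r i) (seq r j) q) ⟩
    ℚ.∣ d ℚ.* q ∣                         ≡⟨ ℚ.∣p*q∣≡∣p∣*∣q∣ d q ⟩
    ℚ.∣ d ∣ ℚ.* ℚ.∣ q ∣                   ≡⟨ cong (ℚ.∣ d ∣ ℚ.*_) (ℚ.0≤p⇒∣p∣≡p (ℚ.nonNegative⁻¹ q {{0≤1/n n}})) ⟩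
    ℚ.∣ d ∣ ℚ.* q                         ≤⟨ ℚ.*-monoˡ-≤-nonNeg ℚ.∣ d ∣ {{ℚ.∣-∣-nonNeg d}} (1/n≤1 n) ⟩
    ℚ.∣ d ∣ ℚ.* 1ℚ                        ≡⟨ ℚ.*-identityʳ ℚ.∣ d ∣ ⟩
    ℚ.∣ d ∣                               <⟨ N-ok i j le le′ ⟩
    ε                                     ∎
  where
  open ℚ.≤-Reasoning
  open +-*-Solver
  q = + 1 ℚ./ n
  lemma : ∀ a b c → a ℚ.* c ℚ.- b ℚ.* c ≡ (a ℚ.- b) ℚ.* c
  lemma = solve 3 (λ a b c → a :* c :- b :* c := (a :- b) :* c) refl

-- The sequence is indexed by the positive integers.
_⟶_ : ((n : ℕ) .{{_ : NonZero n}} → ℝ) → ℝ → Set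
a ⟶ s = ∀ ε → 0ℚ ℚ.< ε → ∃[ N ] (∀ n .{{_ : NonZero n}} → N ℕ.≤ n → ∣ a n - s ∣ < fromℚ ε)

harmonic : ℕ → ℚ
harmonic zero    = 0ℚ
harmonic (suc n) = harmonic n ℚ.+ (+ 1 ℚ./ suc n)

-- The right-endpoint Riemann sum of ∫₁ᵏ dt/t with mesh 1/M, where M = suc N:
-- it equals 1/(M+1) + 1/(M+2) + ⋯ + 1/(kM).
logSum : ℕ → ℕ → ℚ
logSum k N = harmonic (k ℕ.* suc N) ℚ.- harmonic (suc N)

private
  1/ : ℕ → ℚ
  1/ n = + 1 ℚ./ suc n

  /-+-1 : ∀ j d .{{_ : NonZero d}} → (+ j ℚ./ d) ℚ.+ (+ 1 ℚ./ d) ≡ + suc j ℚ./ d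
  /-+-1 j (suc d) = ℚ.toℚᵘ-injective (begin
    ℚ.toℚᵘ (fromᵘ j ℚ.+ fromᵘ 1)           ≈⟨ ℚ.toℚᵘ-homo-+ (fromᵘ j) (fromᵘ 1) ⟩
    ℚ.toℚᵘ (fromᵘ j) ℚᵘ.+ ℚ.toℚᵘ (fromᵘ 1) ≈⟨ ℚᵘ.+-cong (ℚ.toℚᵘ-fromℚᵘ (ℚᵘ.mkℚᵘ (+ j) d)) (ℚ.toℚᵘ-fromℚᵘ (ℚᵘ.mkℚᵘ (+ 1) d)) ⟩
    ℚᵘ.mkℚᵘ (+ j) d ℚᵘ.+ ℚᵘ.mkℚᵘ (+ 1) d   ≈⟨ ℚᵘ.*≡* (lemma (+ j) (+ suc d)) ⟩
    ℚᵘ.mkℚᵘ (+ suc j) d                    ≈⟨ ℚ.toℚᵘ-fromℚᵘ (ℚᵘ.mkℚᵘ (+ suc j) d) ⟨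
    ℚ.toℚᵘ (fromᵘ (suc j))                 ∎)
    where
    open import Relation.Binary.Reasoning.Setoid ℚᵘ.≃-setoid
    fromᵘ : ℕ → ℚ
    fromᵘ i = + i ℚ./ suc d
    lemma : ∀ a e → (a ℤ.* e ℤ.+ + 1 ℤ.* e) ℤ.* e ≡ (+ 1 ℤ.+ a) ℤ.* (e ℤ.* e)
    lemma = solve-∀

  harmonic-lower : ∀ j m d .{{_ : NonZero d}} → j ℕ.+ m ℕ.≤ d →
                   harmonic m ℚ.+ (+ j ℚ./ d) ℚ.≤ harmonic (j ℕ.+ m)
  harmonic-lower zero    m (suc d) le = ℚ.≤-reflexive
    (trans (cong (harmonic m ℚ.+_) (ℚ.≤-antisym (/-mono 0 0 (suc d) 1 ℕ.z≤n) (/-mono 0 0 1 (suc d) ℕ.z≤n)))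
           (ℚ.+-identityʳ (harmonic m)))
  harmonic-lower (suc j) m d le = begin
    harmonic m ℚ.+ (+ suc j ℚ./ d)                    ≡⟨ cong (harmonic m ℚ.+_) (/-+-1 j d) ⟨
    harmonic m ℚ.+ ((+ j ℚ./ d) ℚ.+ (+ 1 ℚ./ d))      ≡⟨ ℚ.+-assoc (harmonic m) _ _ ⟨
    harmonic m ℚ.+ (+ j ℚ./ d) ℚ.+ (+ 1 ℚ./ d)        ≤⟨ ℚ.+-mono-≤ (harmonic-lower j m d (ℕ.<⇒≤ le))
                                                           (/-mono 1 1 d (suc (j ℕ.+ m)) (ℕ.+-monoˡ-≤ 0 le)) ⟩
    harmonic (j ℕ.+ m) ℚ.+ 1/ (j ℕ.+ m)               ∎
    where open ℚ.≤-Reasoning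

  harmonic-upper : ∀ j m d .{{_ : NonZero d}} → d ℕ.≤ m →
                   harmonic (j ℕ.+ m) ℚ.≤ harmonic m ℚ.+ (+ j ℚ./ d)
  harmonic-upper zero    m (suc d) le = ℚ.≤-reflexive
    (trans (sym (ℚ.+-identityʳ (harmonic m)))
           (cong (harmonic m ℚ.+_) (ℚ.≤-antisym (/-mono 0 0 1 (suc d) ℕ.z≤n) (/-mono 0 0 (suc d) 1 ℕ.z≤n))))
  harmonic-upper (suc j) m d le = begin
    harmonic (j ℕ.+ m) ℚ.+ 1/ (j ℕ.+ m)               ≤⟨ ℚ.+-mono-≤ (harmonic-upper j m d le)
                                                           (/-mono 1 1 (suc (j ℕ.+ m)) d
                                                             (ℕ.+-monoˡ-≤ 0 (ℕ.≤-trans le (ℕ.m≤n⇒m≤1+n (ℕ.m≤n+m m j))))) ⟩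
    harmonic m ℚ.+ (+ j ℚ./ d) ℚ.+ (+ 1 ℚ./ d)        ≡⟨ ℚ.+-assoc (harmonic m) _ _ ⟩
    harmonic m ℚ.+ ((+ j ℚ./ d) ℚ.+ (+ 1 ℚ./ d))      ≡⟨ cong (harmonic m ℚ.+_) (/-+-1 j d) ⟩
    harmonic m ℚ.+ (+ suc j ℚ./ d)                    ∎
    where open ℚ.≤-Reasoning

  cancel-/ : ∀ k n .{{_ : NonZero k}} .{{_ : NonZero (k ℕ.* suc n)}} → + k ℚ./ (k ℕ.* suc n) ≡ 1/ n
  cancel-/ k n = ℚ.≤-antisym
    (/-mono k 1 (k ℕ.* suc n) (suc n) (ℕ.≤-reflexive (sym (ℕ.*-identityˡ (k ℕ.* suc n)))))
    (/-mono 1 k (suc n) (k ℕ.* suc n) (ℕ.≤-reflexive (ℕ.*-identityˡ (k ℕ.* suc n))))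

  module _ (k : ℕ) .{{_ : NonZero k}} where

    step-lower : ∀ n → logSum k n ℚ.≤ logSum k (suc n)
    step-lower n = begin
      harmonic (k ℕ.* suc n) ℚ.- h                                       ≡⟨ lemma (harmonic (k ℕ.* suc n)) h (1/ (suc n)) ⟩
      (harmonic (k ℕ.* suc n) ℚ.+ 1/ (suc n)) ℚ.- (h ℚ.+ 1/ (suc n))     ≤⟨ ℚ.+-monoˡ-≤ (ℚ.- (h ℚ.+ 1/ (suc n))) bound ⟩
      harmonic (k ℕ.* suc (suc n)) ℚ.- (h ℚ.+ 1/ (suc n))                ∎
      where
      open ℚ.≤-Reasoning
      open +-*-Solver
      h = harmonic (suc n)
      instance _ = ℕ.m*n≢0 k (suc (suc n))
      lemma : ∀ p q r → p ℚ.- q ≡ (p ℚ.+ r) ℚ.- (q ℚ.+ r)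
      lemma = solve 3 (λ p q r → p :- q := (p :+ r) :- (q :+ r)) refl
      eq : k ℕ.* suc (suc n) ≡ k ℕ.+ k ℕ.* suc n
      eq = ℕ.*-suc k (suc n)
      bound : harmonic (k ℕ.* suc n) ℚ.+ 1/ (suc n) ℚ.≤ harmonic (k ℕ.* suc (suc n))
      bound = subst₂ (λ p q → harmonic (k ℕ.* suc n) ℚ.+ p ℚ.≤ harmonic q)
        (cancel-/ k (suc n)) (sym eq)
        (harmonic-lower k (k ℕ.* suc n) (k ℕ.* suc (suc n)) (ℕ.≤-reflexive (sym eq)))

    step-upper : ∀ n → logSum k (suc n) ℚ.+ 1/ (suc n) ℚ.≤ logSum k n ℚ.+ 1/ n
    step-upper n = begin
      harmonic (k ℕ.* suc (suc n)) ℚ.- (h ℚ.+ 1/ (suc n)) ℚ.+ 1/ (suc n) ≡⟨ lemma (harmonic (k ℕ.* suc (suc n))) h (1/ (suc n)) ⟩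
      harmonic (k ℕ.* suc (suc n)) ℚ.- h                                 ≤⟨ ℚ.+-monoˡ-≤ (ℚ.- h) bound ⟩
      harmonic (k ℕ.* suc n) ℚ.+ 1/ n ℚ.- h                              ≡⟨ lemma′ (harmonic (k ℕ.* suc n)) (1/ n) h ⟩
      harmonic (k ℕ.* suc n) ℚ.- h ℚ.+ 1/ n                              ∎
      where
      open ℚ.≤-Reasoning
      open +-*-Solver
      h = harmonic (suc n)
      instance _ = ℕ.m*n≢0 k (suc n)
      lemma : ∀ p q r → p ℚ.- (q ℚ.+ r) ℚ.+ r ≡ p ℚ.- q
      lemma = solve 3 (λ p q r → p :- (q :+ r) :+ r := p :- q) refl
      lemma′ : ∀ p q r → p ℚ.+ q ℚ.- r ≡ p ℚ.- r ℚ.+ q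
      lemma′ = solve 3 (λ p q r → p :+ q :- r := p :- r :+ q) refl
      bound : harmonic (k ℕ.* suc (suc n)) ℚ.≤ harmonic (k ℕ.* suc n) ℚ.+ 1/ n
      bound = subst₂ (λ p q → harmonic q ℚ.≤ harmonic (k ℕ.* suc n) ℚ.+ p)
        (cancel-/ k n) (sym (ℕ.*-suc k (suc n)))
        (harmonic-upper k (k ℕ.* suc n) (k ℕ.* suc n) ℕ.≤-refl)

    within : ∀ N d → logSum k N ℚ.≤ logSum k (d ℕ.+ N) ×
                     logSum k (d ℕ.+ N) ℚ.+ 1/ (d ℕ.+ N) ℚ.≤ logSum k N ℚ.+ 1/ N
    within N zero    = ℚ.≤-refl , ℚ.≤-refl
    within N (suc d) = ℚ.≤-trans (proj₁ (within N d)) (step-lower (d ℕ.+ N))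
                     , ℚ.≤-trans (step-upper (d ℕ.+ N)) (proj₂ (within N d))

    logSum-diff : ∀ N m n → N ℕ.≤ m → N ℕ.≤ n → logSum k m ℚ.- logSum k n ℚ.≤ 1/ N
    logSum-diff N m n N≤m N≤n = p-q≤r (begin
      logSum k m            ≡⟨ ℚ.+-identityʳ _ ⟨
      logSum k m ℚ.+ 0ℚ     ≤⟨ ℚ.+-monoʳ-≤ (logSum k m) (ℚ.nonNegative⁻¹ (1/ m) {{0≤1/n (suc m)}}) ⟩
      logSum k m ℚ.+ 1/ m   ≤⟨ subst (λ i → logSum k i ℚ.+ 1/ i ℚ.≤ logSum k N ℚ.+ 1/ N)
                                 (ℕ.m∸n+n≡m N≤m) (proj₂ (within N (m ℕ.∸ N))) ⟩
      logSum k N ℚ.+ 1/ N   ≤⟨ ℚ.+-monoˡ-≤ (1/ N) (subst (λ i → logSum k N ℚ.≤ logSum k i)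
                                 (ℕ.m∸n+n≡m N≤n) (proj₁ (within N (n ℕ.∸ N)))) ⟩
      logSum k n ℚ.+ 1/ N   ∎)
      where open ℚ.≤-Reasoning

    logSum-cauchy : ∀ N m n → N ℕ.≤ m → N ℕ.≤ n → ℚ.∣ logSum k m ℚ.- logSum k n ∣ ℚ.≤ 1/ N
    logSum-cauchy N m n N≤m N≤n = ∣∣-lub (logSum-diff N m n N≤m N≤n)
      (subst (ℚ._≤ 1/ N) (lemma (logSum k n) (logSum k m)) (logSum-diff N n m N≤n N≤m))
      where
      open +-*-Solver
      lemma : ∀ p q → p ℚ.- q ≡ ℚ.- (q ℚ.- p)
      lemma = solve 2 (λ p q → p :- q := :- (q :- p)) refl

  archimedean : ∀ ε → 0ℚ ℚ.< ε → ∃[ N ] (1/ N ℚ.< ε)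
  archimedean ε@(ℚ.mkℚ (+ suc p) d-1 _) _ = suc d-1 ,
    subst (1/ (suc d-1) ℚ.<_) (ℚ.↥p/↧p≡p ε)
      (fromℚᵘ-mono-< {ℚᵘ.mkℚᵘ (+ 1) (suc d-1)} {ℚᵘ.mkℚᵘ (+ suc p) d-1}
        (ℚᵘ.*<* (ℤ.+<+ le)))
    where
    le : 1 ℕ.* suc d-1 ℕ.< suc p ℕ.* suc (suc d-1)
    le = ℕ.≤-trans (ℕ.≤-reflexive (cong suc (ℕ.*-identityˡ (suc d-1)))) (ℕ.m≤m+n (suc (suc d-1)) _)
  archimedean (ℚ.mkℚ (+ 0) _ _)      (ℚ.*<* (ℤ.+<+ ()))
  archimedean (ℚ.mkℚ ℤ.-[1+ _ ] _ _) (ℚ.*<* ())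

-- The natural logarithm, log k = ∫₁ᵏ dt/t; log 0 is a junk value.
log : ℕ → ℝ
log zero      = fromℚ 0ℚ
log k@(suc _) = real (logSum k) λ ε 0<ε →
  let N , 1/N<ε = archimedean ε 0<ε
  in N , λ m n le le′ → ℚ.≤-<-trans (logSum-cauchy k N m n le le′) 1/N<ε

{-# OPTIONS --safe #-}

-- Superadditivity of log (T n) alone (Fekete's lemma) gives no modulus of convergence, which a
-- constructive limit needs, so the growth rate is bounded from both sides.  Placing one building on
-- top of another gives T m * T n ≤ T (m + n).  Conversely, cutting a spanning tree splits a building
-- of n blocks into two contiguous buildings that share one block and are of comparable size; the
-- building is recovered from these by naming the shared block in both of them and a rotation, so that
-- T n ≤ n ^ O(1) * T m * T l for some m + l = n with m, l ≥ n / 6.  Splitting repeatedly, until all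
-- parts have their size in a window [N, K N], bounds log (T n) / n by the maximum of log (T m) / m
-- over the window, up to O(log N / N); superadditivity bounds it from below by the same maximum.

module Submission where

open import Defs hiding (_<_; _-_; ∣_∣)
open import Data.Fin.Base using (Fin; zero; suc; toℕ; fromℕ<; inject≤)
open import Data.Fin.Properties using (*↔×; injective⇒≤; toℕ-injective; fromℕ<-injective; toℕ-inject≤)
open import Data.Integer.Base as ℤ using (ℤ; +_; 0ℤ; 1ℤ)
import Data.Integer.Properties as ℤ
open import Data.Integer.Tactic.RingSolver using () renaming (solve-∀ to ℤ-solve-∀)
open import Data.List.Base using (List; []; _∷_; _++_; length; map; lookup; deduplicate; concatMap; upTo)
open import Data.List.Membership.Propositional using (_∈_; _∉_; find; lose)
open import Data.List.Membership.Propositional.Properties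
  using (∈-∃++; ∈-++⁺ˡ; ∈-++⁺ʳ; ∈-++⁻; ∈-map⁺; ∈-map⁻; ∈-concatMap⁺; ∈-upTo⁺; ∈-lookup)
open import Data.List.Properties using (length-++; length-map; map-cong; ++-identityʳ; ++-assoc)
open import Data.List.Relation.Binary.BagAndSetEquality using (_∼[_]_; set; [_]-Equality)
open import Data.List.Relation.Binary.Permutation.Propositional
  using (_↭_; ↭-refl; ↭-sym; ↭-trans; ↭⇒↭ₛ; module PermutationReasoning)
open import Data.List.Relation.Binary.Permutation.Propositional.Properties
  using (∈-resp-↭; ↭-length; ++⁺ˡ; shift; shifts)
import Data.List.Relation.Binary.Permutation.Setoid.Properties as Perm
open import Data.List.Relation.Binary.Subset.Propositional using (_⊆_)
open import Data.List.Relation.Unary.All as All using (All; []; _∷_; _[_]≔_)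
open import Data.List.Relation.Unary.All.Properties using (¬Any⇒All¬; All¬⇒¬Any; ¬All⇒Any¬; ++⁺; ++⁻)
open import Data.List.Relation.Unary.AllPairs using (AllPairs; []; _∷_)
import Data.List.Relation.Unary.AllPairs.Properties as AllPairs
open import Data.List.Relation.Unary.Any as Any using (Any; here; there; any?)
open import Data.List.Relation.Unary.Enumerates.Setoid.Properties using (deduplicate⁺; lookup-surjective)
open import Data.List.Relation.Unary.Unique.DecSetoid.Properties using (deduplicate-!)
open import Data.List.Relation.Unary.Unique.Propositional using (Unique)
open import Data.List.Relation.Unary.Unique.Propositional.Properties using (map⁺)
open import Data.Nat.Base as ℕ using (ℕ; zero; suc; NonZero; z≤n; s≤s; _/_; _%_)
open import Data.Nat.DivMod using (m≡m%n+[m/n]*n; m%n<n; m*n/n≡m; m/n≤m; /-monoˡ-≤)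
open import Data.Nat.Induction using (<-rec)
import Data.Nat.Properties as ℕ
open import Data.Nat.Tactic.RingSolver using (solve-∀)
open import Data.Product.Base using (Σ-syntax; ∃-syntax; _×_; _,_; proj₁; proj₂; swap)
open import Data.Product.Properties using (,-injective)
open import Data.Rational.Base as ℚ using (ℚ; 0ℚ; 1ℚ; ½)
import Data.Rational.Properties as ℚ
import Data.Rational.Unnormalised.Base as ℚᵘ
import Data.Rational.Unnormalised.Properties as ℚᵘ
open import Data.Sum.Base as Sum using (_⊎_; inj₁; inj₂; [_,_]′)
open import Data.Unit.Base using (⊤; tt)
open import Function.Base using (_∘_; id)
open import Function.Bundles using (Equivalence; mk⇔; module Bijection; module Inverse; Injection)
open import Function.Properties.Inverse using (↔-sym; ↔⇒↣)
open import Level using (0ℓ)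
open import Relation.Binary.Bundles using (Setoid; DecSetoid)
open import Relation.Binary.Construct.Closure.ReflexiveTransitive as Star using (Star; _◅_; _◅◅_)
open import Relation.Binary.Definitions using (Decidable; DecidableEquality; Symmetric)
open import Relation.Binary.PropositionalEquality
  using (_≡_; _≢_; refl; sym; trans; cong; cong₂; subst; subst₂; setoid; module ≡-Reasoning)
open import Relation.Nullary using (Dec; yes; no; ¬_; contradiction)
open import Relation.Nullary.Decidable using (map′; _×-dec_; _⊎-dec_; ¬?)

-- The shared block keeps both parts of a cut connected, and it also fixes the loss. A cut is
-- encoded by a rotation (4 values), the names of the shared block in the two parts and the size of
-- one part (n values each at most), hence a factor 4 n ^ 3. The block is counted in both parts, so
-- their sizes add up to n + 1; removing the excess block costs another factor of this order, n ^ 6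
-- in all. Multiplying `T n` by n ^ 7 turns this into `b n ≤ b m * b l` for a suitable n = m + l,
-- because m and l are both of order n. Rates are compared by inequalities between powers of natural
-- numbers, `f m ^ n ≤ f n ^ m`. Such inequalities are decidable, so a maximum over a window is
-- found by search; logarithms enter only at the end, through Riemann sums. Stacking and cutting act
-- on chosen representatives of the classes. Only the injectivity of the resulting maps matters,
-- never that they respect identification.

⊆-antisym : ∀ {A : Set} {xs ys : List A} → xs ⊆ ys → ys ⊆ xs → xs ∼[ set ] ys
⊆-antisym xs⊆ys ys⊆xs = mk⇔ xs⊆ys ys⊆xs

-- Lists without repetitions, and counting by inclusion

Unique-resp-↭ : ∀ {A : Set} {xs ys : List A} → xs ↭ ys → Unique xs → Unique ys
Unique-resp-↭ xs↭ys = Perm.Unique-resp-↭ (setoid _) (↭⇒↭ₛ xs↭ys)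

Unique-∷⁻ : ∀ {A : Set} {x : A} {xs} → Unique (x ∷ xs) → x ∉ xs
Unique-∷⁻ (x≢ ∷ _) = All¬⇒¬Any x≢

Unique-++⁻ : ∀ {A : Set} (xs : List A) {ys} → Unique (xs ++ ys) → Unique xs × Unique ys
Unique-++⁻ []       u        = [] , u
Unique-++⁻ (x ∷ xs) (x≢ ∷ u) =
  let x≢xs , _ = ++⁻ xs x≢ ; uxs , uys = Unique-++⁻ xs u in x≢xs ∷ uxs , uys

Unique-⊆⇒length-≤ : ∀ {A : Set} {xs ys : List A} → Unique xs → xs ⊆ ys → length xs ℕ.≤ length ys
Unique-⊆⇒length-≤ [] _ = z≤n
Unique-⊆⇒length-≤ {xs = x ∷ xs} u@(_ ∷ uxs) xs⊆ys with ∈-∃++ (xs⊆ys (here refl))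
... | as , bs , refl = ℕ.≤-trans (s≤s (Unique-⊆⇒length-≤ uxs xs⊆))
  (ℕ.≤-reflexive (trans (cong suc (length-++ as)) (trans (sym (ℕ.+-suc _ _)) (sym (length-++ as)))))
  where
  xs⊆ : xs ⊆ as ++ bs
  xs⊆ y∈xs with ∈-++⁻ as (xs⊆ys (there y∈xs))
  ... | inj₁ y∈as         = ∈-++⁺ˡ y∈as
  ... | inj₂ (here refl)  = contradiction y∈xs (Unique-∷⁻ u)
  ... | inj₂ (there y∈bs) = ∈-++⁺ʳ as y∈bs

-- An element of ys outside xs could be added to xs, contradicting the length bound. This turns
-- equal sizes into equal sets throughout.
Unique-⊆-full : ∀ {A : Set} {xs ys : List A} → DecidableEquality A → Unique xs → xs ⊆ ys → length ys ℕ.≤ length xs → ys ⊆ xs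
Unique-⊆-full {xs = xs} _≟_ u xs⊆ys len {y} y∈ys with any? (y ≟_) xs
... | yes y∈xs = y∈xs
... | no  y∉xs = contradiction
  (ℕ.≤-trans (Unique-⊆⇒length-≤ (¬Any⇒All¬ xs y∉xs ∷ u) λ { (here refl) → y∈ys ; (there p) → xs⊆ys p }) len)
  ℕ.1+n≰n

AllPairs-lookup : ∀ {A : Set} {xs : List A} {R : A → A → Set} → Symmetric R → AllPairs R xs →
  ∀ {x y} → x ∈ xs → y ∈ xs → x ≢ y → R x y
AllPairs-lookup sm (_ ∷ _)  (here refl) (here refl) x≢y = contradiction refl x≢y
AllPairs-lookup sm (r ∷ _)  (here refl) (there q)   _   = All.lookup r q
AllPairs-lookup sm (r ∷ _)  (there p)   (here refl) _   = sm (All.lookup r p)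
AllPairs-lookup sm (_ ∷ rs) (there p)   (there q)   x≢y = AllPairs-lookup sm rs p q x≢y

AllPairs-tabulate : ∀ {A : Set} {xs : List A} {R : A → A → Set} → Unique xs →
  (∀ {x y} → x ∈ xs → y ∈ xs → x ≢ y → R x y) → AllPairs R xs
AllPairs-tabulate []        r = []
AllPairs-tabulate (x≢ ∷ u) r =
  All.tabulate (λ y∈ → r (here refl) (there y∈) (All.lookup x≢ y∈)) ∷
  AllPairs-tabulate u (λ p q → r (there p) (there q))

-- Counting the classes of a setoid

AllPairs-lookup-injective : ∀ {A : Set} {_≈_ : A → A → Set} → Symmetric _≈_ → ∀ {xs} →
  AllPairs (λ x y → ¬ x ≈ y) xs → ∀ {i j} → lookup xs i ≈ lookup xs j → i ≡ j
AllPairs-lookup-injective sm (_ ∷ _)  {zero}  {zero}  _  = refl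
AllPairs-lookup-injective sm (x ∷ _)  {zero}  {suc j} eq = contradiction eq (All.lookup x (∈-lookup j))
AllPairs-lookup-injective sm (x ∷ _)  {suc i} {zero}  eq = contradiction (sm eq) (All.lookup x (∈-lookup i))
AllPairs-lookup-injective sm (_ ∷ xs) {suc i} {suc j} eq = cong suc (AllPairs-lookup-injective sm xs eq)

-- Deduplication up to `_≈_` leaves exactly one representative of each class, so `lookup` in the
-- remaining list is the bijection.
enumerated⇒finite : (S : Setoid 0ℓ 0ℓ) → let open Setoid S in Decidable _≈_ →
  (xs : List Carrier) → (∀ x → Any (x ≈_) xs) → ∃[ k ] HasCardinality S k
enumerated⇒finite S _≟_ xs enum = length ys , record
  { to        = lookup ys
  ; cong      = λ { refl → S.refl }
  ; bijective = AllPairs-lookup-injective S.sym (deduplicate-! DS xs) , lookup-surjective S (deduplicate⁺ DS enum)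
  }
  where
  module S = Setoid S
  DS : DecSetoid 0ℓ 0ℓ
  DS = record { isDecEquivalence = record { isEquivalence = S.isEquivalence ; _≟_ = _≟_ } }
  ys = deduplicate _≟_ xs

module Classes {S : Setoid 0ℓ 0ℓ} {k : ℕ} (card : HasCardinality S k) where
  open Setoid S

  rep : Fin k → Carrier
  rep = Bijection.to card

  class : Carrier → Fin k
  class x = proj₁ (Bijection.surjective card x)

  rep-class : ∀ x → rep (class x) ≈ x
  rep-class x = proj₂ (Bijection.surjective card x) _≡_.refl

  rep-injective : ∀ {i j} → rep i ≈ rep j → i ≡ j
  rep-injective = Bijection.injective card

  class-injective : ∀ {x y} → class x ≡ class y → x ≈ y
  class-injective {x} {y} eq = Setoid.trans S (Setoid.sym S (rep-class x))
    (Setoid.trans S (Setoid.reflexive S (cong rep eq)) (rep-class y))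

product-≤ : ∀ {a b c} (f : Fin a × Fin b → Fin c) → (∀ {p q} → f p ≡ f q → p ≡ q) → a ℕ.* b ℕ.≤ c
product-≤ {a} {b} f inj = injective⇒≤ {f = λ i → f (Inverse.to (*↔× {a} {b}) i)}
  λ eq → Injection.injective (↔⇒↣ (*↔× {a} {b})) (inj eq)

pair : ∀ {a b} → Fin a × Fin b → Fin (a ℕ.* b)
pair {a} {b} = Inverse.from (*↔× {a} {b})

pair-injective : ∀ a b {p q : Fin a × Fin b} → pair p ≡ pair q → p ≡ q
pair-injective a b = Injection.injective (↔⇒↣ (↔-sym (*↔× {a} {b})))

-- Growth rates of sequences of natural numbers

module Rates where

  open import Data.Nat.Base using (_+_; _*_; _^_; _∸_; _⊔_; _≤_; _<_; z<s; s≤s⁻¹; >-nonZero; >-nonZero⁻¹)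
  open import Data.Nat.Properties

  ^-distribʳ-* : ∀ a b n → (a * b) ^ n ≡ a ^ n * b ^ n
  ^-distribʳ-* a b zero    = refl
  ^-distribʳ-* a b (suc n) = trans (cong (a * b *_) (^-distribʳ-* a b n)) (lemma a b (a ^ n) (b ^ n))
    where
    lemma : ∀ a b c d → a * b * (c * d) ≡ a * c * (b * d)
    lemma = solve-∀

  -- This takes the place of extracting n-th roots.
  ^-cancelˡ-≤ : ∀ n .{{_ : NonZero n}} {a b} → a ^ n ≤ b ^ n → a ≤ b
  ^-cancelˡ-≤ n {a} {b} le with a ≤? b
  ... | yes a≤b = a≤b
  ... | no  a≰b = contradiction le (<⇒≱ (^-monoˡ-< n (≰⇒> a≰b)))

  n<2^n : ∀ n → n < 2 ^ n
  n<2^n zero    = z<s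
  n<2^n (suc n) = begin-strict
    suc n           ≤⟨ n<2^n n ⟩
    2 ^ n           <⟨ m<n+m (2 ^ n) (m^n>0 2 n) ⟩
    2 ^ n + 2 ^ n   ≡⟨ cong (λ i → 2 ^ n + i) (+-identityʳ (2 ^ n)) ⟨
    2 ^ suc n       ∎
    where open ≤-Reasoning

  ^-swap : ∀ a m n → (a ^ m) ^ n ≡ (a ^ n) ^ m
  ^-swap a m n = trans (^-*-assoc a m n) (trans (cong (a ^_) (*-comm m n)) (sym (^-*-assoc a n m)))

  -- The exponent is written as d + (2 e + 1) so that the induction starts where (e + 1) ^ 2 ≤ 4 ^ e
  -- already suffices; from there on each step doubles the right side and at most doubles the left.
  linear≤2^ : ∀ e d → e * suc (d + suc (e + e)) ≤ 2 ^ (d + suc (e + e))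
  linear≤2^ e zero    = begin
    e * suc (suc (e + e))          ≤⟨ m≤m+n _ (e + e + 2) ⟩
    e * suc (suc (e + e)) + (e + e + 2) ≡⟨ lemma e ⟩
    2 * (suc e * suc e)            ≤⟨ *-monoʳ-≤ 2 (*-mono-≤ (n<2^n e) (n<2^n e)) ⟩
    2 * (2 ^ e * 2 ^ e)            ≡⟨ cong (2 *_) (^-distribˡ-+-* 2 e e) ⟨
    2 ^ suc (e + e)                ∎
    where
    open ≤-Reasoning
    lemma : ∀ e → e * suc (suc (e + e)) + (e + e + 2) ≡ 2 * (suc e * suc e)
    lemma = solve-∀
  linear≤2^ e (suc d) = begin
    e * suc (suc q)      ≤⟨ *-monoʳ-≤ e (s≤s (m≤n+m (suc q) q)) ⟩
    e * suc (q + suc q)  ≡⟨ lemma e q ⟩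
    2 * (e * suc q)      ≤⟨ *-monoʳ-≤ 2 (linear≤2^ e d) ⟩
    2 ^ suc q            ∎
    where
    open ≤-Reasoning
    q = d + suc (e + e)
    lemma : ∀ e q → e * suc (q + suc q) ≡ 2 * (e * suc q)
    lemma = solve-∀

  -- With q = m / e, the bound m ≤ e (q + 1) ≤ 2 ^ q gives m ^ e ≤ 2 ^ (q e) ≤ 2 ^ m.
  power≤2^ : ∀ e → ∃[ N ] (∀ m → N ≤ m → m ^ e ≤ 2 ^ m)
  power≤2^ zero        = 0 , λ m _ → m^n>0 2 m
  power≤2^ e@(suc _) = suc (e + e) * e , bound
    where
    open ≤-Reasoning
    bound : ∀ m → suc (e + e) * e ≤ m → m ^ e ≤ 2 ^ m
    bound m N≤m = begin
      m ^ e            ≤⟨ ^-monoˡ-≤ e m≤2^q ⟩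
      (2 ^ q) ^ e      ≡⟨ ^-*-assoc 2 q e ⟩
      2 ^ (q * e)      ≤⟨ ^-monoʳ-≤ 2 (subst (q * e ≤_) (sym (m≡m%n+[m/n]*n m e)) (m≤n+m (q * e) (m % e))) ⟩
      2 ^ m            ∎
      where
      q = m / e
      q≥ : suc (e + e) ≤ q
      q≥ = subst (_≤ q) (m*n/n≡m (suc (e + e)) e) (/-monoˡ-≤ e N≤m)
      m≤2^q : m ≤ 2 ^ q
      m≤2^q = begin
        m                ≡⟨ m≡m%n+[m/n]*n m e ⟩
        m % e + q * e    ≤⟨ +-monoˡ-≤ (q * e) (<⇒≤ (m%n<n m e)) ⟩
        e + q * e        ≡⟨ *-comm (suc q) e ⟩
        e * suc q        ≤⟨ subst (λ i → e * suc i ≤ 2 ^ i) (m∸n+n≡m q≥) (linear≤2^ e (q ∸ suc (e + e))) ⟩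
        2 ^ q            ∎

  abstract
    -- The seventh power of the hypothesis has n ^ 14 on the left, one factor n more than the goal;
    -- that factor pays for the constants.
    power-bound : ∀ K .{{_ : NonZero K}} a →
      ∃[ N ] (∀ n p → N ≤ n → n * n ≤ K * p → a * n ^ 13 ≤ p ^ 7)
    power-bound K a = K ^ 7 * a , λ n p N≤n n²≤Kp → *-cancelˡ-≤ (K ^ 7) {{m^n≢0 K 7}} (begin
      K ^ 7 * (a * n ^ 13)    ≡⟨ *-assoc (K ^ 7) a (n ^ 13) ⟨
      K ^ 7 * a * n ^ 13      ≤⟨ *-monoˡ-≤ (n ^ 13) N≤n ⟩
      n ^ 14                  ≡⟨ ^-distribˡ-+-* n 7 7 ⟩
      n ^ 7 * n ^ 7           ≡⟨ ^-distribʳ-* n n 7 ⟨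
      (n * n) ^ 7             ≤⟨ ^-monoˡ-≤ 7 n²≤Kp ⟩
      (K * p) ^ 7             ≡⟨ ^-distribʳ-* K p 7 ⟩
      K ^ 7 * p ^ 7           ∎)
      where open ≤-Reasoning

  module _ (_≼_ : ℕ → ℕ → Set) (≼-total : ∀ m n → m ≼ n ⊎ n ≼ m) (N : ℕ)
           (≼-trans : ∀ {l m n} → N ≤ m → l ≼ m → m ≼ n → l ≼ n) where

    -- Transitivity is asked only through middle terms m ≥ N, because the comparison of rates below
    -- is not transitive through 0. Reflexivity comes from totality.
    window-maximum : ∀ d → ∃[ m ] (N ≤ m × m ≤ d + N × (∀ l → N ≤ l → l ≤ d + N → l ≼ m))
    window-maximum zero = N , ≤-refl , ≤-refl , λ l N≤l l≤N →
      subst (_≼ N) (≤-antisym N≤l l≤N) ([ id , id ]′ (≼-total N N))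
    window-maximum (suc d) with window-maximum d
    ... | m , N≤m , m≤ , max with ≼-total m (suc d + N)
    ... | inj₁ m≼ = suc d + N , m≤n+m N (suc d) , ≤-refl , λ l N≤l l≤ →
            [ (λ l< → ≼-trans N≤m (max l N≤l (s≤s⁻¹ l<)) m≼)
            , (λ { refl → [ id , id ]′ (≼-total l l) }) ]′ (m≤n⇒m<n∨m≡n l≤)
    ... | inj₂ ≼m = m , N≤m , m≤n⇒m≤1+n m≤ , λ l N≤l l≤ →
            [ (λ l< → max l N≤l (s≤s⁻¹ l<)) , (λ { refl → ≼m }) ]′ (m≤n⇒m<n∨m≡n l≤)

  -- m ≼ n compares the growth rates: log (f m) / m ≤ log (f n) / n.
  module _ (f : ℕ → ℕ) where

    infix 4 _≼_
    _≼_ : ℕ → ℕ → Set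
    m ≼ n = f m ^ n ≤ f n ^ m

    ≼-total : ∀ m n → m ≼ n ⊎ n ≼ m
    ≼-total m n = ≤-total (f m ^ n) (f n ^ m)

    -- After raising to the m-th power, exponents commute and the two hypotheses can be chained; the
    -- power is then cancelled.
    ≼-trans : ∀ {l m n} .{{_ : NonZero m}} → l ≼ m → m ≼ n → l ≼ n
    ≼-trans {l} {m} {n} l≼m m≼n = ^-cancelˡ-≤ m (begin
      (f l ^ n) ^ m  ≡⟨ ^-swap (f l) n m ⟩
      (f l ^ m) ^ n  ≤⟨ ^-monoˡ-≤ n l≼m ⟩
      (f m ^ l) ^ n  ≡⟨ ^-swap (f m) l n ⟩
      (f m ^ n) ^ l  ≤⟨ ^-monoˡ-≤ l m≼n ⟩
      (f n ^ m) ^ l  ≡⟨ ^-swap (f n) m l ⟩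
      (f n ^ l) ^ m  ∎)
      where open ≤-Reasoning

    -- By strong induction: both parts of a number beyond the window [N, K N + N] are still at least N.
    window-bound : ∀ K N .{{_ : NonZero N}} →
      (∀ n → N ≤ n → ∃[ m ] ∃[ l ] (m + l ≡ n × n ≤ K * m × n ≤ K * l × f n ≤ f m * f l)) →
      ∃[ m ] (N ≤ m × (∀ n → N ≤ n → n ≼ m))
    window-bound K N split = m₀ , N≤m₀ , <-rec (λ n → N ≤ n → n ≼ m₀) λ n rec N≤n → go n rec N≤n
      where
      open ≤-Reasoning
      best = window-maximum _≼_ ≼-total N (λ N≤m → ≼-trans {{>-nonZero (<-≤-trans (>-nonZero⁻¹ N) N≤m)}}) (K * N)
      m₀ = proj₁ best
      N≤m₀ = proj₁ (proj₂ best)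
      go : ∀ n → (∀ {m} → m < n → N ≤ m → m ≼ m₀) → N ≤ n → n ≼ m₀
      go n rec N≤n with n ≤? K * N + N
      ... | yes n≤ = proj₂ (proj₂ (proj₂ best)) n N≤n n≤
      ... | no  n≰ with split n N≤n
      ... | m , l , refl , n≤Km , n≤Kl , fn≤ = begin
        f (m + l) ^ m₀            ≤⟨ ^-monoˡ-≤ m₀ fn≤ ⟩
        (f m * f l) ^ m₀          ≡⟨ ^-distribʳ-* (f m) (f l) m₀ ⟩
        f m ^ m₀ * f l ^ m₀       ≤⟨ *-mono-≤ (rec (m<m+n m (<-≤-trans N>0 N≤l)) N≤m) (rec (m<n+m l (<-≤-trans N>0 N≤m)) N≤l) ⟩
        f m₀ ^ m * f m₀ ^ l       ≡⟨ ^-distribˡ-+-* (f m₀) m l ⟨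
        f m₀ ^ (m + l)            ∎
        where
        N>0 = >-nonZero⁻¹ N
        large : ∀ i → m + l ≤ K * i → N ≤ i
        large i le = <⇒≤ (*-cancelˡ-< K N i (≤-<-trans (m≤m+n (K * N) N) (<-≤-trans (≰⇒> n≰) le)))
        N≤m = large m n≤Km
        N≤l = large l n≤Kl

  -- Rates of a supermultiplicative sequence that splits up to a polynomial factor

  module _ (T : ℕ → ℕ)
           (T-pos : ∀ n → 1 ≤ n → 1 ≤ T n)
           (T-super : ∀ m n → 1 ≤ m → 1 ≤ n → T m * T n ≤ T (m + n))
           (T-split : ∀ N n → 2 ≤ N → N ≤ n → ∃[ m ] ∃[ l ] (m + l ≡ suc n × N ≤ m × m < 2 * N × m ≤ n ×
                        T n ≤ 4 * n ^ 3 * (T m * T l)))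
    where

    open ≤-Reasoning

    T-mono : ∀ {m n} → 1 ≤ m → m ≤ n → T m ≤ T n
    T-mono {m} {n} 1≤m m≤n = subst (λ i → T m ≤ T i) (m∸n+n≡m m≤n) (go (n ∸ m))
      where
      go : ∀ d → T m ≤ T (d + m)
      go zero    = ≤-refl
      go (suc d) = begin
        T m              ≤⟨ go d ⟩
        T (d + m)        ≡⟨ *-identityˡ _ ⟨
        1 * T (d + m)    ≤⟨ *-monoˡ-≤ (T (d + m)) (T-pos 1 ≤-refl) ⟩
        T 1 * T (d + m)  ≤⟨ T-super 1 (d + m) ≤-refl (≤-trans 1≤m (m≤n+m m d)) ⟩
        T (suc d + m)    ∎

    C : ℕ
    C = 4 * T 3

    -- Splitting with N = 2 cuts off a part of 2 or 3 blocks, which accounts for the `T 3` in `C`;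
    -- the other part then has at most l blocks.
    T-suc : ∀ l → 1 ≤ l → T (suc l) ≤ C * suc l ^ 3 * T l
    T-suc l 1≤l with T-split 2 (suc l) ≤-refl (s≤s 1≤l)
    ... | m , l′ , eq , 2≤m , m<4 , m≤ , le = begin
      T (suc l)                       ≤⟨ le ⟩
      4 * suc l ^ 3 * (T m * T l′)    ≤⟨ *-monoʳ-≤ (4 * suc l ^ 3) (*-mono-≤ (T-mono (<⇒≤ 2≤m) (s≤s⁻¹ m<4)) (T-mono 1≤l′ l′≤l)) ⟩
      4 * suc l ^ 3 * (T 3 * T l)     ≡⟨ lemma (suc l ^ 3) (T 3) (T l) ⟩
      C * suc l ^ 3 * T l             ∎
      where
      lemma : ∀ a b c → 4 * a * (b * c) ≡ 4 * b * a * c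
      lemma = solve-∀
      1≤l′ : 1 ≤ l′
      1≤l′ = +-cancelˡ-≤ m 1 l′ (subst₂ _≤_ (+-comm 1 m) (sym eq) (s≤s m≤))
      l′≤l : l′ ≤ l
      l′≤l = +-cancelˡ-≤ 2 l′ l (subst (2 + l′ ≤_) eq (+-monoˡ-≤ l′ 2≤m))

    -- With N = n / 3 the first part takes between one and two thirds. The second part is one block
    -- too large, as the shared block is counted twice, and `T-suc` removes that block.
    T-balanced : ∀ n → 6 ≤ n → ∃[ m ] ∃[ l ] (m + l ≡ n × n ≤ 6 * m × n ≤ 6 * l ×
                   T n ≤ 4 * C * n ^ 6 * (T m * T l))
    T-balanced n 6≤n with T-split (n / 3) n (/-monoˡ-≤ 3 6≤n) (m/n≤m n 3)
    ... | m , zero  , eq , N≤m , m<2N , m≤n , le = contradiction m≤n (<⇒≱ (≤-reflexive (sym (trans (sym (+-identityʳ m)) eq))))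
    ... | m , suc l , eq , N≤m , m<2N , m≤n , le = m , l , m+l≡n , n≤6* m N≤m , n≤6* l N≤l , (begin
      T n                                            ≤⟨ le ⟩
      4 * n ^ 3 * (T m * T (suc l))                  ≤⟨ *-monoʳ-≤ (4 * n ^ 3) (*-monoʳ-≤ (T m) (T-suc l (≤-trans (<⇒≤ 2≤N) N≤l))) ⟩
      4 * n ^ 3 * (T m * (C * suc l ^ 3 * T l))      ≤⟨ *-monoʳ-≤ (4 * n ^ 3) (*-monoʳ-≤ (T m) (*-monoˡ-≤ (T l) (*-monoʳ-≤ C (^-monoˡ-≤ 3 l<n)))) ⟩
      4 * n ^ 3 * (T m * (C * n ^ 3 * T l))          ≡⟨ lemma n C (T m) (T l) ⟩
      4 * C * n ^ 6 * (T m * T l)                    ∎)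
      where
      N = n / 3
      2≤N : 2 ≤ N
      2≤N = /-monoˡ-≤ 3 6≤n
      m+l≡n : m + l ≡ n
      m+l≡n = suc-injective (trans (sym (+-suc m l)) eq)
      l<n : l < n
      l<n = subst (l <_) m+l≡n (m<n+m l (<-≤-trans (<⇒≤ 2≤N) N≤m))
      n≡ : n ≡ n % 3 + N * 3
      n≡ = m≡m%n+[m/n]*n n 3
      n≤6* : ∀ i → N ≤ i → n ≤ 6 * i
      n≤6* i N≤i = begin
        n                ≡⟨ n≡ ⟩
        n % 3 + N * 3    ≤⟨ +-monoˡ-≤ (N * 3) (<⇒≤ (m%n<n n 3)) ⟩
        3 + N * 3        ≤⟨ +-monoˡ-≤ (N * 3) (*-monoˡ-≤ 3 (<⇒≤ 2≤N)) ⟩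
        N * 3 + N * 3    ≡⟨ double N ⟩
        6 * N            ≤⟨ *-monoʳ-≤ 6 N≤i ⟩
        6 * i            ∎
        where
        double : ∀ a → a * 3 + a * 3 ≡ 6 * a
        double = solve-∀
      N≤l : N ≤ l
      N≤l = +-cancelˡ-≤ (2 * N) N l (begin
        2 * N + N        ≡⟨ triple N ⟩
        N * 3            ≤⟨ subst (N * 3 ≤_) (sym n≡) (m≤n+m (N * 3) (n % 3)) ⟩
        n                ≡⟨ m+l≡n ⟨
        m + l            ≤⟨ +-monoˡ-≤ l (<⇒≤ m<2N) ⟩
        2 * N + l        ∎)
        where
        triple : ∀ a → 2 * a + a ≡ a * 3
        triple = solve-∀
      lemma : ∀ n c a b → 4 * (n * (n * (n * 1))) * (a * (c * (n * (n * (n * 1))) * b)) ≡ 4 * c * (n * (n * (n * (n * (n * (n * 1)))))) * (a * b)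
      lemma = solve-∀

    -- The factor n ^ 7 absorbs the loss n ^ 6 in T-balanced: (m l) ^ 7 is of order n ^ 14.
    b : ℕ → ℕ
    b n = T n * n ^ 7

    -- The constant is 36 = 6 * 6, since both parts in `T-balanced` have at least n / 6 blocks, so n
    -- * n ≤ 36 * (m * l).
    N₀ : ℕ
    N₀ = proj₁ (power-bound 36 (4 * C))

    b-split : ∀ n → 6 ≤ n → N₀ ≤ n → ∃[ m ] ∃[ l ] (m + l ≡ n × n ≤ 6 * m × n ≤ 6 * l × b n ≤ b m * b l)
    b-split n 6≤n N₀≤n with T-balanced n 6≤n
    ... | m , l , eq , n≤6m , n≤6l , le = m , l , eq , n≤6m , n≤6l , (begin
      T n * n ^ 7                                  ≤⟨ *-monoˡ-≤ (n ^ 7) le ⟩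
      4 * C * n ^ 6 * (T m * T l) * n ^ 7          ≡⟨ rearrange (4 * C) (n ^ 6) (T m * T l) (n ^ 7) ⟩
      T m * T l * (4 * C * (n ^ 6 * n ^ 7))        ≡⟨ cong (λ i → T m * T l * (4 * C * i)) (^-distribˡ-+-* n 6 7) ⟨
      T m * T l * (4 * C * n ^ 13)                 ≤⟨ *-monoʳ-≤ (T m * T l) poly ⟩
      T m * T l * (m ^ 7 * l ^ 7)                  ≡⟨ interchange (T m) (T l) (m ^ 7) (l ^ 7) ⟩
      T m * m ^ 7 * (T l * l ^ 7)                  ∎)
      where
      rearrange : ∀ a b c d → a * b * c * d ≡ c * (a * (b * d))
      rearrange = solve-∀
      interchange : ∀ a b c d → a * b * (c * d) ≡ a * c * (b * d)
      interchange = solve-∀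
      36ml : ∀ m l → 6 * m * (6 * l) ≡ 36 * (m * l)
      36ml = solve-∀
      poly : 4 * C * n ^ 13 ≤ m ^ 7 * l ^ 7
      poly = subst (4 * C * n ^ 13 ≤_) (^-distribʳ-* m l 7)
        (proj₂ (power-bound 36 (4 * C)) n (m * l) N₀≤n (subst (n * n ≤_) (36ml m l) (*-mono-≤ n≤6m n≤6l)))

    -- For the multiple q m of m with q m ≤ n < q m + m, superadditivity gives T m ^ q ≤ T n.
    rate-lower : ∀ m n → 1 ≤ m → 1 ≤ n → T m ^ n ≤ T n ^ m * T m ^ m
    rate-lower m n 1≤m = <-rec (λ n → 1 ≤ n → T m ^ n ≤ T n ^ m * T m ^ m) step n
      where
      instance
        _ = >-nonZero (T-pos m 1≤m)
      step : ∀ n → (∀ {i} → i < n → 1 ≤ i → T m ^ i ≤ T i ^ m * T m ^ m) → 1 ≤ n → T m ^ n ≤ T n ^ m * T m ^ m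
      step n rec 1≤n with n ≤? m
      ... | yes n≤m = begin
        T m ^ n              ≤⟨ ^-monoʳ-≤ (T m) n≤m ⟩
        T m ^ m              ≡⟨ *-identityˡ _ ⟨
        1 * T m ^ m          ≤⟨ *-monoˡ-≤ (T m ^ m) (m^n>0 (T n) {{>-nonZero (T-pos n 1≤n)}} m) ⟩
        T n ^ m * T m ^ m    ∎
      ... | no n≰m with m≤n⇒∃[o]m+o≡n (≰⇒> n≰m)
      ... | o , refl = begin
        T m ^ suc (m + o)                      ≡⟨ cong (T m ^_) (+-suc m o) ⟨
        T m ^ (m + suc o)                      ≡⟨ ^-distribˡ-+-* (T m) m (suc o) ⟩
        T m ^ m * T m ^ suc o                  ≤⟨ *-monoʳ-≤ (T m ^ m) (rec (s≤s (m<n+m o 1≤m)) (s≤s z≤n)) ⟩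
        T m ^ m * (T (suc o) ^ m * T m ^ m)    ≡⟨ *-assoc (T m ^ m) (T (suc o) ^ m) (T m ^ m) ⟨
        T m ^ m * T (suc o) ^ m * T m ^ m      ≡⟨ cong (_* T m ^ m) (^-distribʳ-* (T m) (T (suc o)) m) ⟨
        (T m * T (suc o)) ^ m * T m ^ m        ≤⟨ *-monoˡ-≤ (T m ^ m) (^-monoˡ-≤ m (T-super m (suc o) 1≤m (s≤s z≤n))) ⟩
        T (m + suc o) ^ m * T m ^ m            ≡⟨ cong (λ i → T i ^ m * T m ^ m) (+-suc m o) ⟩
        T (suc (m + o)) ^ m * T m ^ m          ∎

    -- Taking logarithms: log (T n) / n ≤ log (T n′) / n′ + log 4 / E.
    effective-rates : ∀ E → ∃[ N ] (∀ n n′ → N ≤ n → N ≤ n′ → T n ^ (n′ * E) ≤ T n′ ^ (n * E) * 4 ^ (n * n′))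
    effective-rates E = N , bound
      where
      P = proj₁ (power≤2^ (7 * E))
      -- 6 makes `T-balanced` applicable, N₀ absorbs its polynomial loss, and P gives m ^ (7 E) ≤ 2
      -- ^ m for the weight m ^ 7 of the maximiser m.
      N₁ = 6 ⊔ (N₀ ⊔ P)
      6≤N₁ : 6 ≤ N₁
      6≤N₁ = m≤m⊔n 6 (N₀ ⊔ P)
      N₀≤N₁ : N₀ ≤ N₁
      N₀≤N₁ = ≤-trans (m≤m⊔n N₀ P) (m≤n⊔m 6 _)
      P≤N₁ : P ≤ N₁
      P≤N₁ = ≤-trans (m≤n⊔m N₀ P) (m≤n⊔m 6 _)
      instance
        _ = >-nonZero (≤-trans (s≤s z≤n) 6≤N₁)
      window = window-bound b 6 N₁ λ n N₁≤n → b-split n (≤-trans 6≤N₁ N₁≤n) (≤-trans N₀≤N₁ N₁≤n)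
      m = proj₁ window
      N₁≤m = proj₁ (proj₂ window)
      1≤m : 1 ≤ m
      1≤m = ≤-trans (≤-trans (s≤s z≤n) 6≤N₁) N₁≤m
      -- The remainder `T m ^ m` of `rate-lower` is negligible once n′ ≥ T m * E, by the crude bound
      -- T m ≤ 2 ^ T m. This remainder and the weight m ^ 7 each cost 2 ^ (n n′ m), which together
      -- is the m-th power of 4 ^ (n n′).
      N = N₁ ⊔ T m * E
      bound : ∀ n n′ → N ≤ n → N ≤ n′ → T n ^ (n′ * E) ≤ T n′ ^ (n * E) * 4 ^ (n * n′)
      bound n n′ N≤n N≤n′ = ^-cancelˡ-≤ m {{>-nonZero 1≤m}} (begin
        (T n ^ (n′ * E)) ^ m                   ≡⟨ ^-swap (T n) (n′ * E) m ⟩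
        (T n ^ m) ^ (n′ * E)                   ≤⟨ ^-monoˡ-≤ (n′ * E) T≤ ⟩
        (T m ^ n * (m ^ 7) ^ n) ^ (n′ * E)     ≡⟨ ^-distribʳ-* (T m ^ n) ((m ^ 7) ^ n) (n′ * E) ⟩
        (T m ^ n) ^ (n′ * E) * ((m ^ 7) ^ n) ^ (n′ * E) ≤⟨ *-mono-≤ main small₁ ⟩
        ((T n′ ^ (n * E)) ^ m * 2 ^ (n * n′ * m)) * 2 ^ (n * n′ * m) ≡⟨ *-assoc ((T n′ ^ (n * E)) ^ m) _ _ ⟩
        (T n′ ^ (n * E)) ^ m * (2 ^ (n * n′ * m) * 2 ^ (n * n′ * m)) ≡⟨ cong ((T n′ ^ (n * E)) ^ m *_) (^-distribʳ-* 2 2 (n * n′ * m)) ⟨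
        (T n′ ^ (n * E)) ^ m * 4 ^ (n * n′ * m)  ≡⟨ cong ((T n′ ^ (n * E)) ^ m *_) (^-*-assoc 4 (n * n′) m) ⟨
        (T n′ ^ (n * E)) ^ m * (4 ^ (n * n′)) ^ m  ≡⟨ ^-distribʳ-* (T n′ ^ (n * E)) (4 ^ (n * n′)) m ⟨
        (T n′ ^ (n * E) * 4 ^ (n * n′)) ^ m    ∎)
        where
        N₁≤n = ≤-trans (m≤m⊔n N₁ _) N≤n
        N₁≤n′ = ≤-trans (m≤m⊔n N₁ _) N≤n′
        1≤n = ≤-trans (≤-trans (s≤s z≤n) 6≤N₁) N₁≤n
        1≤n′ = ≤-trans (≤-trans (s≤s z≤n) 6≤N₁) N₁≤n′
        T≤ : T n ^ m ≤ T m ^ n * (m ^ 7) ^ n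
        T≤ = begin
          T n ^ m              ≤⟨ ^-monoˡ-≤ m (m≤m*n (T n) (n ^ 7) {{m^n≢0 n 7 {{>-nonZero 1≤n}}}}) ⟩
          b n ^ m              ≤⟨ proj₂ (proj₂ window) n N₁≤n ⟩
          b m ^ n              ≡⟨ ^-distribʳ-* (T m) (m ^ 7) n ⟩
          T m ^ n * (m ^ 7) ^ n ∎
        small₁ : ((m ^ 7) ^ n) ^ (n′ * E) ≤ 2 ^ (n * n′ * m)
        small₁ = begin
          ((m ^ 7) ^ n) ^ (n′ * E)   ≡⟨ ^-*-assoc (m ^ 7) n (n′ * E) ⟩
          (m ^ 7) ^ (n * (n′ * E))   ≡⟨ ^-*-assoc m 7 (n * (n′ * E)) ⟩
          m ^ (7 * (n * (n′ * E)))   ≡⟨ cong (m ^_) (exps n n′ E) ⟩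
          m ^ (7 * E * (n * n′))     ≡⟨ ^-*-assoc m (7 * E) (n * n′) ⟨
          (m ^ (7 * E)) ^ (n * n′)   ≤⟨ ^-monoˡ-≤ (n * n′) (proj₂ (power≤2^ (7 * E)) m (≤-trans P≤N₁ N₁≤m)) ⟩
          (2 ^ m) ^ (n * n′)         ≡⟨ ^-*-assoc 2 m (n * n′) ⟩
          2 ^ (m * (n * n′))         ≡⟨ cong (2 ^_) (*-comm m (n * n′)) ⟩
          2 ^ (n * n′ * m)           ∎
          where
          exps : ∀ a b c → 7 * (a * (b * c)) ≡ 7 * c * (a * b)
          exps = solve-∀
        main : (T m ^ n) ^ (n′ * E) ≤ (T n′ ^ (n * E)) ^ m * 2 ^ (n * n′ * m)
        main = begin
          (T m ^ n) ^ (n′ * E)                             ≡⟨ ^-*-assoc (T m) n (n′ * E) ⟩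
          T m ^ (n * (n′ * E))                             ≡⟨ cong (T m ^_) (exps n n′ E) ⟩
          T m ^ (n′ * (n * E))                             ≡⟨ ^-*-assoc (T m) n′ (n * E) ⟨
          (T m ^ n′) ^ (n * E)                             ≤⟨ ^-monoˡ-≤ (n * E) (rate-lower m n′ 1≤m 1≤n′) ⟩
          (T n′ ^ m * T m ^ m) ^ (n * E)                   ≡⟨ ^-distribʳ-* (T n′ ^ m) (T m ^ m) (n * E) ⟩
          (T n′ ^ m) ^ (n * E) * (T m ^ m) ^ (n * E)       ≤⟨ *-mono-≤ (≤-reflexive (^-swap (T n′) m (n * E))) small₂ ⟩
          (T n′ ^ (n * E)) ^ m * 2 ^ (n * n′ * m)          ∎
          where
          exps : ∀ a b c → a * (b * c) ≡ b * (a * c)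
          exps = solve-∀
          small₂ : (T m ^ m) ^ (n * E) ≤ 2 ^ (n * n′ * m)
          small₂ = begin
            (T m ^ m) ^ (n * E)          ≤⟨ ^-monoˡ-≤ (n * E) (^-monoˡ-≤ m (<⇒≤ (n<2^n (T m)))) ⟩
            ((2 ^ T m) ^ m) ^ (n * E)    ≡⟨ cong (_^ (n * E)) (^-*-assoc 2 (T m) m) ⟩
            (2 ^ (T m * m)) ^ (n * E)    ≡⟨ ^-*-assoc 2 (T m * m) (n * E) ⟩
            2 ^ (T m * m * (n * E))      ≡⟨ cong (2 ^_) (exps₃ (T m) m n E) ⟩
            2 ^ (n * (T m * E) * m)      ≤⟨ ^-monoʳ-≤ 2 (*-monoˡ-≤ m (*-monoʳ-≤ n (≤-trans (m≤n⊔m N₁ (T m * E)) N≤n′))) ⟩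
            2 ^ (n * n′ * m)             ∎
            where
            exps₃ : ∀ a b c d → a * b * (c * d) ≡ c * (a * d) * b
            exps₃ = solve-∀

-- Logarithms and limits

module Limits where

  open import Data.Rational.Solver using (module +-*-Solver)
  open +-*-Solver


  0<½*ε : ∀ {ε} → 0ℚ ℚ.< ε → 0ℚ ℚ.< ½ ℚ.* ε
  0<½*ε {ε} 0<ε = subst (ℚ._< ½ ℚ.* ε) (ℚ.*-zeroʳ ½) (ℚ.*-monoʳ-<-pos ½ 0<ε)

  p≤∣p∣ : ∀ p → p ℚ.≤ ℚ.∣ p ∣
  p≤∣p∣ p with ℚ.≤-total 0ℚ p
  ... | inj₁ 0≤p = ℚ.≤-reflexive (sym (ℚ.0≤p⇒∣p∣≡p 0≤p))
  ... | inj₂ p≤0 = ℚ.≤-trans p≤0 (ℚ.0≤∣p∣ p)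

  ∣p-q∣<r⇒p≤q+r : ∀ {p q r} → ℚ.∣ p ℚ.- q ∣ ℚ.< r → p ℚ.≤ q ℚ.+ r
  ∣p-q∣<r⇒p≤q+r {p} {q} {r} lt = begin
    p                      ≡⟨ solve 2 (λ p q → p := q :+ (p :- q)) refl p q ⟩
    q ℚ.+ (p ℚ.- q)        ≤⟨ ℚ.+-monoʳ-≤ q (p≤∣p∣ (p ℚ.- q)) ⟩
    q ℚ.+ ℚ.∣ p ℚ.- q ∣    ≤⟨ ℚ.+-monoʳ-≤ q (ℚ.<⇒≤ lt) ⟩
    q ℚ.+ r                ∎
    where open ℚ.≤-Reasoning

  p≤q+r⇒p-q≤r : ∀ {p q r} → p ℚ.≤ q ℚ.+ r → p ℚ.- q ℚ.≤ r
  p≤q+r⇒p-q≤r {p} {q} {r} le = subst (p ℚ.- q ℚ.≤_)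
    (solve 2 (λ q r → (q :+ r) :- q := r) refl q r) (ℚ.+-monoˡ-≤ (ℚ.- q) le)

  ∣p-q∣≤r : ∀ {p q r} → p ℚ.≤ q ℚ.+ r → q ℚ.≤ p ℚ.+ r → ℚ.∣ p ℚ.- q ∣ ℚ.≤ r
  ∣p-q∣≤r {p} {q} {r} p≤q+r q≤p+r with ℚ.∣p∣≡p∨∣p∣≡-p (p ℚ.- q)
  ... | inj₁ eq = subst (ℚ._≤ r) (sym eq) (p≤q+r⇒p-q≤r p≤q+r)
  ... | inj₂ eq = subst (ℚ._≤ r)
    (sym (trans eq (solve 2 (λ p q → :- (p :- q) := q :- p) refl p q))) (p≤q+r⇒p-q≤r q≤p+r)

  ι : ℕ → ℚ
  ι zero    = 0ℚ
  ι (suc n) = 1ℚ ℚ.+ ι n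

  ι-+ : ∀ m n → ι (m ℕ.+ n) ≡ ι m ℚ.+ ι n
  ι-+ zero    n = sym (ℚ.+-identityˡ (ι n))
  ι-+ (suc m) n = trans (cong (1ℚ ℚ.+_) (ι-+ m n)) (sym (ℚ.+-assoc 1ℚ (ι m) (ι n)))

  ι-* : ∀ m n → ι (m ℕ.* n) ≡ ι m ℚ.* ι n
  ι-* zero    n = sym (ℚ.*-zeroˡ (ι n))
  ι-* (suc m) n = trans (ι-+ n (m ℕ.* n)) (trans (cong (ι n ℚ.+_) (ι-* m n))
    (solve 2 (λ m n → n :+ m :* n := (con 1ℚ :+ m) :* n) refl (ι m) (ι n)))

  0≤ι : ∀ n → 0ℚ ℚ.≤ ι n
  0≤ι zero    = ℚ.≤-refl
  0≤ι (suc n) = subst (ℚ._≤ ι (suc n)) (ℚ.+-identityˡ 0ℚ) (ℚ.+-mono-≤ (ℚ.nonNegative⁻¹ 1ℚ) (0≤ι n))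

  ι-mono : ∀ {m n} → m ℕ.≤ n → ι m ℚ.≤ ι n
  ι-mono {n = n} ℕ.z≤n = 0≤ι n
  ι-mono (ℕ.s≤s le)    = ℚ.+-monoʳ-≤ 1ℚ (ι-mono le)

  toℚᵘ-ι : ∀ n → ℚ.toℚᵘ (ι n) ℚᵘ.≃ ℚᵘ.mkℚᵘ (+ n) 0
  toℚᵘ-ι zero    = ℚᵘ.≃-refl
  toℚᵘ-ι (suc n) = ℚᵘ.≃-trans (ℚ.toℚᵘ-homo-+ 1ℚ (ι n))
    (ℚᵘ.≃-trans (ℚᵘ.+-congʳ (ℚᵘ.mkℚᵘ (+ 1) 0) (toℚᵘ-ι n)) (ℚᵘ.*≡* (lemma (+ n))))
    where
    lemma : ∀ a → (+ 1 ℤ.* + 1 ℤ.+ a ℤ.* + 1) ℤ.* + 1 ≡ (+ 1 ℤ.+ a) ℤ.* + 1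
    lemma = ℤ-solve-∀

  inv : (n : ℕ) .{{_ : NonZero n}} → ℚ
  inv n = + 1 ℚ./ n

  inv-nonNeg : ∀ n .{{_ : NonZero n}} → ℚ.NonNegative (inv n)
  inv-nonNeg n = ℚ.normalize-nonNeg 1 n

  0≤inv : ∀ n .{{_ : NonZero n}} → 0ℚ ℚ.≤ inv n
  0≤inv n = ℚ.nonNegative⁻¹ (inv n) {{inv-nonNeg n}}

  0<inv : ∀ n .{{_ : NonZero n}} → 0ℚ ℚ.< inv n
  0<inv n = ℚ.positive⁻¹ (inv n) {{ℚ.normalize-pos 1 n}}

  ι-inv : ∀ n .{{_ : NonZero n}} → ι n ℚ.* inv n ≡ 1ℚ
  ι-inv (suc n) = ℚ.toℚᵘ-injective (ℚᵘ.≃-trans (ℚ.toℚᵘ-homo-* (ι (suc n)) (inv (suc n)))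
    (ℚᵘ.≃-trans (ℚᵘ.*-cong (toℚᵘ-ι (suc n)) (ℚ.toℚᵘ-fromℚᵘ (ℚᵘ.mkℚᵘ (+ 1) n)))
      (ℚᵘ.*≡* (lemma (+ suc n)))))
    where
    lemma : ∀ a → a ℤ.* + 1 ℤ.* + 1 ≡ + 1 ℤ.* (+ 1 ℤ.* a)
    lemma = ℤ-solve-∀

  inv≤1 : ∀ n .{{_ : NonZero n}} → inv n ℚ.≤ 1ℚ
  inv≤1 n = subst₂ ℚ._≤_ (ℚ.*-identityˡ (inv n)) (ι-inv n)
    (ℚ.*-monoʳ-≤-nonNeg (inv n) {{inv-nonNeg n}} (ι-mono (ℕ.>-nonZero⁻¹ n)))

  -- The denominator is at least 1, so the absolute value of the numerator is a crude ceiling.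
  ceiling-bound : ∀ r → r ℚ.≤ ι ℤ.∣ ℚ.↥ r ∣
  ceiling-bound r = ℚ.toℚᵘ-cancel-≤ (ℚᵘ.≤-respʳ-≃ (ℚᵘ.≃-sym (toℚᵘ-ι ℤ.∣ ℚ.↥ r ∣)) (bound r))
    where
    bound : ∀ r → ℚ.toℚᵘ r ℚᵘ.≤ ℚᵘ.mkℚᵘ (+ ℤ.∣ ℚ.↥ r ∣) 0
    bound (ℚ.mkℚ (+ n) d _)      = ℚᵘ.*≤* (subst₂ ℤ._≤_ (ℤ.pos-* n 1) (ℤ.pos-* n (suc d))
      (ℤ.+≤+ (ℕ.*-monoʳ-≤ n (ℕ.s≤s ℕ.z≤n))))
    bound (ℚ.mkℚ ℤ.-[1+ n ] d _) = ℚᵘ.*≤* ℤ.-≤+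

  abstract
    archimedes : ∀ p ε → 0ℚ ℚ.< ε → ∃[ E ] (p ℚ.≤ ι E ℚ.* ε)
    archimedes p ε 0<ε = ℤ.∣ ℚ.↥ r ∣ , (begin
      p                      ≡⟨ ℚ.*-identityʳ p ⟨
      p ℚ.* 1ℚ               ≡⟨ cong (p ℚ.*_) (ℚ.*-inverseˡ ε) ⟨
      p ℚ.* (ℚ.1/ ε ℚ.* ε)   ≡⟨ ℚ.*-assoc p (ℚ.1/ ε) ε ⟨
      r ℚ.* ε                ≤⟨ ℚ.*-monoʳ-≤-nonNeg ε (ceiling-bound r) ⟩
      ι ℤ.∣ ℚ.↥ r ∣ ℚ.* ε    ∎)
      where
      open ℚ.≤-Reasoning
      instance
        ε-pos : ℚ.Positive ε
        ε-pos = ℚ.positive 0<ε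
        ε-nonZero : ℚ.NonZero ε
        ε-nonZero = ℚ.pos⇒nonZero ε
        ε-nonNeg : ℚ.NonNegative ε
        ε-nonNeg = ℚ.pos⇒nonNeg ε
      r : ℚ
      r = p ℚ.* ℚ.1/ ε

    inv-≤ : ∀ p ε → 0ℚ ℚ.≤ p → 0ℚ ℚ.< ε → ∃[ N ] (∀ n .{{_ : NonZero n}} → N ℕ.≤ n → p ℚ.* inv n ℚ.≤ ε)
    inv-≤ p ε 0≤p 0<ε = let N , p≤Nε = archimedes p ε 0<ε in N , λ n N≤n → let instance _ = inv-nonNeg n in begin
      p ℚ.* inv n               ≤⟨ ℚ.*-monoʳ-≤-nonNeg (inv n) (ℚ.≤-trans p≤Nε (ℚ.*-monoʳ-≤-nonNeg ε (ι-mono N≤n))) ⟩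
      ι n ℚ.* ε ℚ.* inv n       ≡⟨ solve 3 (λ a b c → a :* b :* c := b :* (a :* c)) refl (ι n) ε (inv n) ⟩
      ε ℚ.* (ι n ℚ.* inv n)     ≡⟨ cong (ε ℚ.*_) (ι-inv n) ⟩
      ε ℚ.* 1ℚ                  ≡⟨ ℚ.*-identityʳ ε ⟩
      ε                         ∎
      where
      open ℚ.≤-Reasoning
      instance
        ε-nonNeg : ℚ.NonNegative ε
        ε-nonNeg = ℚ.pos⇒nonNeg ε {{ℚ.positive 0<ε}}

  quarter : ℚ → ℚ
  quarter ε = ½ ℚ.* (½ ℚ.* ε)

  quarters : ∀ ε → quarter ε ℚ.+ quarter ε ℚ.+ quarter ε ℚ.+ quarter ε ≡ ε
  quarters = solve 1 (λ e → let q = con ½ :* (con ½ :* e) in q :+ q :+ q :+ q := e) refl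

  0<quarter : ∀ {ε} → 0ℚ ℚ.< ε → 0ℚ ℚ.< quarter ε
  0<quarter 0<ε = 0<½*ε (0<½*ε 0<ε)

  p<p+q : ∀ p {q} → 0ℚ ℚ.< q → p ℚ.< p ℚ.+ q
  p<p+q p {q} 0<q = subst (ℚ._< p ℚ.+ q) (ℚ.+-identityʳ p) (ℚ.+-monoʳ-< p 0<q)

  -- Completeness of the reals by a diagonal sequence

  module _ (a : (n : ℕ) .{{_ : NonZero n}} → ℝ)
           (close : ∀ ε → 0ℚ ℚ.< ε → ∃[ N ] (∀ m n .{{_ : NonZero m}} .{{_ : NonZero n}} → N ℕ.≤ m → N ℕ.≤ n →
                      ∃[ J ] (∀ j → J ℕ.≤ j → seq (a m) j ℚ.≤ seq (a n) j ℚ.+ ε)))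
    where

    private
      modulus : ∀ n .{{_ : NonZero n}} → ∃[ M ] (∀ i j → M ℕ.≤ i → M ℕ.≤ j → ℚ.∣ seq (a n) i ℚ.- seq (a n) j ∣ ℚ.< inv n)
      modulus n = cauchy (a n) (inv n) (0<inv n)

      approx : (n : ℕ) .{{_ : NonZero n}} → ℚ
      approx n = seq (a n) (proj₁ (modulus n))

      approx-above : ∀ n .{{_ : NonZero n}} j → proj₁ (modulus n) ℕ.≤ j → seq (a n) j ℚ.≤ approx n ℚ.+ inv n
      approx-above n j le = ∣p-q∣<r⇒p≤q+r (proj₂ (modulus n) j _ le ℕ.≤-refl)

      approx-below : ∀ n .{{_ : NonZero n}} j → proj₁ (modulus n) ℕ.≤ j → approx n ℚ.≤ seq (a n) j ℚ.+ inv n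
      approx-below n j le = ∣p-q∣<r⇒p≤q+r (proj₂ (modulus n) _ j ℕ.≤-refl le)

      -- Entry n is a rational within 1/n of the real `a n`; entry 0 is a dummy value.
      diagonal : ℕ → ℚ
      diagonal zero    = 0ℚ
      diagonal (suc n) = approx (suc n)

      module _ (ε : ℚ) (0<ε : 0ℚ ℚ.< ε) where

        q : ℚ
        q = quarter ε

        small : ∃[ N ] (∀ n .{{_ : NonZero n}} → N ℕ.≤ n → 1ℚ ℚ.* inv n ℚ.≤ q)
        small = inv-≤ 1ℚ q (ℚ.nonNegative⁻¹ 1ℚ) (0<quarter 0<ε)

        N : ℕ
        N = suc (proj₁ small ℕ.⊔ proj₁ (close q (0<quarter 0<ε)))

        inv≤q : ∀ n .{{_ : NonZero n}} → N ℕ.≤ n → inv n ℚ.≤ q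
        inv≤q n N≤n = subst (ℚ._≤ q) (ℚ.*-identityˡ (inv n))
          (proj₂ small n (ℕ.m⊔n≤o⇒m≤o (proj₁ small) (proj₁ (close q (0<quarter 0<ε))) (ℕ.≤-trans (ℕ.n≤1+n _) N≤n)))

        -- Both entries are compared with their reals at one late index j. Two of the quarters cover
        -- the errors 1/m and 1/n, the third the closeness of `a m` and `a n`.
        diagonal-≤ : ∀ m n → N ℕ.≤ m → N ℕ.≤ n → diagonal m ℚ.≤ diagonal n ℚ.+ (q ℚ.+ q ℚ.+ q)
        diagonal-≤ m@(suc _) n@(suc _) N≤m N≤n = begin
          approx m                               ≤⟨ approx-below m j (ℕ.≤-trans (ℕ.m≤m⊔n _ _) (ℕ.m≤n⊔m J _)) ⟩
          seq (a m) j ℚ.+ inv m                  ≤⟨ ℚ.+-mono-≤ (proj₂ J-close j (ℕ.m≤m⊔n J _)) (inv≤q m N≤m) ⟩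
          (seq (a n) j ℚ.+ q) ℚ.+ q              ≤⟨ ℚ.+-monoˡ-≤ q (ℚ.+-monoˡ-≤ q (ℚ.≤-trans
                                                      (approx-above n j (ℕ.≤-trans (ℕ.m≤n⊔m (proj₁ (modulus m)) _) (ℕ.m≤n⊔m J _)))
                                                      (ℚ.+-monoʳ-≤ (approx n) (inv≤q n N≤n)))) ⟩
          ((approx n ℚ.+ q) ℚ.+ q) ℚ.+ q         ≡⟨ solve 2 (λ a q → ((a :+ q) :+ q) :+ q := a :+ (q :+ q :+ q)) refl (approx n) q ⟩
          approx n ℚ.+ (q ℚ.+ q ℚ.+ q)           ∎
          where
          open ℚ.≤-Reasoning
          big : ∀ {i} → N ℕ.≤ i → proj₁ (close q (0<quarter 0<ε)) ℕ.≤ i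
          big N≤i = ℕ.m⊔n≤o⇒n≤o (proj₁ small) _ (ℕ.≤-trans (ℕ.n≤1+n _) N≤i)
          J-close = proj₂ (close q (0<quarter 0<ε)) m n (big N≤m) (big N≤n)
          J = proj₁ J-close
          j = J ℕ.⊔ (proj₁ (modulus m) ℕ.⊔ proj₁ (modulus n))

        3q<ε : q ℚ.+ q ℚ.+ q ℚ.< ε
        3q<ε = subst (q ℚ.+ q ℚ.+ q ℚ.<_) (quarters ε) (p<p+q (q ℚ.+ q ℚ.+ q) (0<quarter 0<ε))

        diagonal-cauchy : ∀ m n → N ℕ.≤ m → N ℕ.≤ n → ℚ.∣ diagonal m ℚ.- diagonal n ∣ ℚ.< ε
        diagonal-cauchy m n N≤m N≤n = ℚ.≤-<-trans
          (∣p-q∣≤r (diagonal-≤ m n N≤m N≤n) (diagonal-≤ n m N≤n N≤m)) 3q<ε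

    complete : Σ[ s ∈ ℝ ] (a ⟶ s)
    complete = s , λ ε 0<ε →
      let δ = quarter ε
          0<δ = 0<quarter 0<ε
      -- Strict inequality of reals demands a positive rational gap. The distance takes 2 δ and the
      -- gap δ, and 3 δ < ε.
      in N δ 0<δ , λ { n@(suc _) N≤n → δ , 0<δ , N δ 0<δ ℕ.⊔ proj₁ (modulus n) , λ j le →
        let N≤j = ℕ.m⊔n≤o⇒m≤o (N δ 0<δ) (proj₁ (modulus n)) le
            M≤j = ℕ.m⊔n≤o⇒n≤o (N δ 0<δ) (proj₁ (modulus n)) le
            inv≤δ = ℚ.≤-trans (inv≤q δ 0<δ n N≤n) (quarter≤ δ 0<δ)
            3q≤δ = ℚ.<⇒≤ (3q<ε δ 0<δ)
        in begin
          ℚ.∣ seq (a n) j ℚ.- diagonal j ∣ ℚ.+ δ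
            ≤⟨ ℚ.+-monoˡ-≤ δ (∣p-q∣≤r
                 (begin
                   seq (a n) j                  ≤⟨ approx-above n j M≤j ⟩
                   approx n ℚ.+ inv n           ≤⟨ ℚ.+-mono-≤ (ℚ.≤-trans (diagonal-≤ δ 0<δ n j N≤n N≤j) (ℚ.+-monoʳ-≤ (diagonal j) 3q≤δ)) inv≤δ ⟩
                   diagonal j ℚ.+ δ ℚ.+ δ       ≡⟨ ℚ.+-assoc (diagonal j) δ δ ⟩
                   diagonal j ℚ.+ (δ ℚ.+ δ)     ∎)
                 (begin
                   diagonal j                   ≤⟨ diagonal-≤ δ 0<δ j n N≤j N≤n ⟩
                   approx n ℚ.+ (q δ 0<δ ℚ.+ q δ 0<δ ℚ.+ q δ 0<δ) ≤⟨ ℚ.+-mono-≤ (ℚ.≤-trans (approx-below n j M≤j) (ℚ.+-monoʳ-≤ (seq (a n) j) inv≤δ)) 3q≤δ ⟩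
                   seq (a n) j ℚ.+ δ ℚ.+ δ      ≡⟨ ℚ.+-assoc (seq (a n) j) δ δ ⟩
                   seq (a n) j ℚ.+ (δ ℚ.+ δ)    ∎)) ⟩
          δ ℚ.+ δ ℚ.+ δ                         ≤⟨ ℚ.<⇒≤ (3q<ε ε 0<ε) ⟩
          ε                                     ∎ }
      where
      open ℚ.≤-Reasoning
      s : ℝ
      s = real diagonal λ ε 0<ε → N ε 0<ε , diagonal-cauchy ε 0<ε
      quarter≤ : ∀ δ → (0<δ : 0ℚ ℚ.< δ) → quarter δ ℚ.≤ δ
      quarter≤ δ 0<δ = ℚ.≤-trans (ℚ.<⇒≤ (ℚ.<-trans (p<p+q (quarter δ) (0<quarter 0<δ)) (p<p+q _ (0<quarter 0<δ)))) (ℚ.<⇒≤ (3q<ε δ 0<δ))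

  -- The logarithm of products and powers

  harmonic-mono : ∀ {m n} → m ℕ.≤ n → harmonic m ℚ.≤ harmonic n
  harmonic-mono {m} {n} m≤n = subst (λ i → harmonic m ℚ.≤ harmonic i) (ℕ.m∸n+n≡m m≤n) (go (n ℕ.∸ m))
    where
    go : ∀ d → harmonic m ℚ.≤ harmonic (d ℕ.+ m)
    go zero    = ℚ.≤-refl
    go (suc d) = ℚ.≤-trans (go d) (subst (ℚ._≤ harmonic (suc d ℕ.+ m)) (ℚ.+-identityʳ _)
      (ℚ.+-monoʳ-≤ (harmonic (d ℕ.+ m)) (0≤inv (suc (d ℕ.+ m)))))

  logSum-mono : ∀ {k l} j → k ℕ.≤ l → logSum k j ℚ.≤ logSum l j
  logSum-mono j k≤l = ℚ.+-monoˡ-≤ (ℚ.- harmonic (suc j)) (harmonic-mono (ℕ.*-monoˡ-≤ (suc j) k≤l))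

  -- Rescaling t by the factor l in ∫₁ᵏ dt/t refines the mesh by the factor l, so the law
  -- log (k l) = log k + log l is exact for the Riemann sums.
  logSum-* : ∀ k l .{{_ : NonZero l}} j → ∃[ i ] (j ℕ.≤ i × logSum (k ℕ.* l) j ≡ logSum k i ℚ.+ logSum l j)
  logSum-* k l@(suc l′) j = j ℕ.+ l′ ℕ.* suc j , ℕ.m≤m+n j _ ,
    trans (cong (λ i → harmonic i ℚ.- harmonic (suc j)) (ℕ.*-assoc k l (suc j)))
      (solve 3 (λ a b c → a :- c := (a :- b) :+ (b :- c)) refl
        (harmonic (k ℕ.* (l ℕ.* suc j))) (harmonic (l ℕ.* suc j)) (harmonic (suc j)))

  seq-log : ∀ k .{{_ : NonZero k}} j → seq (log k) j ≡ logSum k j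
  seq-log (suc k) j = refl

  -- `logSum-*` evaluates one of its two factors at a larger index i in place of j; this bounds the
  -- change.
  logSum-stable : ∀ k .{{_ : NonZero k}} ε → 0ℚ ℚ.< ε →
    ∃[ N ] (∀ i j → N ℕ.≤ i → N ℕ.≤ j → logSum k i ℚ.≤ logSum k j ℚ.+ ε)
  logSum-stable k ε 0<ε = let N , ok = cauchy (log k) ε 0<ε in N , λ i j N≤i N≤j →
    subst₂ (λ p q → p ℚ.≤ q ℚ.+ ε) (seq-log k i) (seq-log k j) (∣p-q∣<r⇒p≤q+r (ok i j N≤i N≤j))

  logSum-1 : ∀ j → logSum 1 j ≡ 0ℚ
  logSum-1 j = trans (cong (λ i → harmonic i ℚ.- harmonic (suc j)) (ℕ.*-identityˡ (suc j))) (ℚ.+-inverseʳ (harmonic (suc j)))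

  -- N serves all exponents e at once: splitting off one factor k moves only that factor to an index
  -- i ≥ j, at a cost of at most ε, so the total error is e ε.
  logSum-^ : ∀ k .{{_ : NonZero k}} ε → 0ℚ ℚ.< ε → ∃[ N ] (∀ e j → N ℕ.≤ j →
    logSum (k ℕ.^ e) j ℚ.≤ ι e ℚ.* (logSum k j ℚ.+ ε) × ι e ℚ.* (logSum k j ℚ.- ε) ℚ.≤ logSum (k ℕ.^ e) j)
  logSum-^ k ε 0<ε = N , bounds
    where
    open ℚ.≤-Reasoning
    N = proj₁ (logSum-stable k ε 0<ε)
    stable = proj₂ (logSum-stable k ε 0<ε)
    bounds : ∀ e j → N ℕ.≤ j → logSum (k ℕ.^ e) j ℚ.≤ ι e ℚ.* (logSum k j ℚ.+ ε) ×
                               ι e ℚ.* (logSum k j ℚ.- ε) ℚ.≤ logSum (k ℕ.^ e) j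
    bounds zero    j N≤j = ℚ.≤-reflexive (trans (logSum-1 j) (sym (ℚ.*-zeroˡ (logSum k j ℚ.+ ε)))) ,
                           ℚ.≤-reflexive (trans (ℚ.*-zeroˡ (logSum k j ℚ.- ε)) (sym (logSum-1 j)))
    bounds (suc e) j N≤j = (begin
        logSum (k ℕ.* k ℕ.^ e) j                                 ≡⟨ eq ⟩
        logSum k i ℚ.+ logSum (k ℕ.^ e) j                        ≤⟨ ℚ.+-mono-≤ (stable i j N≤i N≤j) upper ⟩
        (logSum k j ℚ.+ ε) ℚ.+ ι e ℚ.* (logSum k j ℚ.+ ε)        ≡⟨ suc-* (logSum k j ℚ.+ ε) ⟩
        ι (suc e) ℚ.* (logSum k j ℚ.+ ε)                         ∎) , (begin
        ι (suc e) ℚ.* (logSum k j ℚ.- ε)                         ≡⟨ suc-* (logSum k j ℚ.- ε) ⟨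
        (logSum k j ℚ.- ε) ℚ.+ ι e ℚ.* (logSum k j ℚ.- ε)        ≤⟨ ℚ.+-mono-≤ below lower ⟩
        logSum k i ℚ.+ logSum (k ℕ.^ e) j                        ≡⟨ eq ⟨
        logSum (k ℕ.* k ℕ.^ e) j                                 ∎)
      where
      prod  = logSum-* k (k ℕ.^ e) {{ℕ.m^n≢0 k e}} j
      i     = proj₁ prod
      eq    = proj₂ (proj₂ prod)
      upper = proj₁ (bounds e j N≤j)
      lower = proj₂ (bounds e j N≤j)
      N≤i   = ℕ.≤-trans N≤j (proj₁ (proj₂ prod))
      suc-* : ∀ p → p ℚ.+ ι e ℚ.* p ≡ ι (suc e) ℚ.* p
      suc-* = solve 2 (λ e p → p :+ e :* p := (con 1ℚ :+ e) :* p) refl (ι e)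
      below : logSum k j ℚ.- ε ℚ.≤ logSum k i
      below = p≤q+r⇒p-q≤r (subst (logSum k j ℚ.≤_) (ℚ.+-comm (logSum k i) ε) (stable j i N≤j N≤i))

  -- From the comparison of powers to the limit

  module _ (T : ℕ → ℕ) (T-pos : ∀ n → 1 ℕ.≤ n → 1 ℕ.≤ T n)
           (rates : ∀ E → ∃[ N ] (∀ n n′ → N ℕ.≤ n → N ℕ.≤ n′ →
                      T n ℕ.^ (n′ ℕ.* E) ℕ.≤ T n′ ℕ.^ (n ℕ.* E) ℕ.* 4 ℕ.^ (n ℕ.* n′)))
    where

    private
      -- Any rational bound on log 4 will do. One unit covers the dependence on the index j, the
      -- other the error of `logSum-^`; the absolute value makes the bound non-negative, as `inv-≤`
      -- requires.
      log4-bound : ∃[ B ] (0ℚ ℚ.≤ B × ∃[ N ] (∀ e j → N ℕ.≤ j → logSum (4 ℕ.^ e) j ℚ.≤ ι e ℚ.* B))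
      log4-bound = let N , stable = logSum-stable 4 1ℚ (ℚ.positive⁻¹ 1ℚ)
                       M , power  = logSum-^ 4 1ℚ (ℚ.positive⁻¹ 1ℚ)
                       B          = logSum 4 N ℚ.+ 1ℚ ℚ.+ 1ℚ
        in ℚ.∣ B ∣ , ℚ.0≤∣p∣ B , N ℕ.⊔ M , λ e j le → ℚ.≤-trans (proj₁ (power e j (ℕ.m⊔n≤o⇒n≤o N M le)))
             (ℚ.*-monoˡ-≤-nonNeg (ι e) {{ℚ.nonNegative (0≤ι e)}}
               (ℚ.≤-trans (ℚ.+-monoˡ-≤ 1ℚ (stable j N (ℕ.m⊔n≤o⇒m≤o N M le) ℕ.≤-refl)) (p≤∣p∣ B)))

      -- Taking Riemann sums of both sides of `rates E` and dividing by m n E leaves four errors of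
      -- at most ε / 4: the powers of `T m`, the powers of `T n`, the change of index from i to j,
      -- and B / E for log 4, which determines E.
      rates-close : ∀ ε → 0ℚ ℚ.< ε → ∃[ N ] (∀ m n .{{_ : NonZero m}} .{{_ : NonZero n}} → N ℕ.≤ m → N ℕ.≤ n →
        ∃[ J ] (∀ j → J ℕ.≤ j → seq (log (T m) ÷ m) j ℚ.≤ seq (log (T n) ÷ n) j ℚ.+ ε))
      rates-close ε 0<ε = proj₁ (rates E) , go
        where
        open ℚ.≤-Reasoning
        δ = quarter ε
        0<δ = 0<quarter 0<ε
        B = proj₁ log4-bound
        E-ok = inv-≤ B δ (proj₁ (proj₂ log4-bound)) 0<δ
        E = suc (proj₁ E-ok)
        inv*δ≤δ : ∀ n .{{_ : NonZero n}} → inv n ℚ.* δ ℚ.≤ δ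
        inv*δ≤δ n = subst (inv n ℚ.* δ ℚ.≤_) (ℚ.*-identityˡ δ)
          (ℚ.*-monoʳ-≤-nonNeg δ {{ℚ.pos⇒nonNeg δ {{ℚ.positive 0<δ}}}} (inv≤1 n))
        go : ∀ m n .{{_ : NonZero m}} .{{_ : NonZero n}} → proj₁ (rates E) ℕ.≤ m → proj₁ (rates E) ℕ.≤ n →
          ∃[ J ] (∀ j → J ℕ.≤ j → seq (log (T m) ÷ m) j ℚ.≤ seq (log (T n) ÷ n) j ℚ.+ ε)
        go m n N≤m N≤n = J , λ j J≤j → subst₂ (λ p q → p ℚ.* inv m ℚ.≤ q ℚ.* inv n ℚ.+ ε)
            (sym (seq-log (T m) j)) (sym (seq-log (T n) j)) (final j J≤j)
          where
          instance
            Tm≢0 : NonZero (T m)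
            Tm≢0 = ℕ.>-nonZero (T-pos m (ℕ.>-nonZero⁻¹ m))
            Tn≢0 : NonZero (T n)
            Tn≢0 = ℕ.>-nonZero (T-pos n (ℕ.>-nonZero⁻¹ n))
          powm = logSum-^ (T m) δ 0<δ
          pown = logSum-^ (T n) δ 0<δ
          stan = logSum-stable (T n) δ 0<δ
          J₁ = proj₁ powm
          J₂ = proj₁ pown
          J₃ = proj₁ stan
          J₄ = proj₁ (proj₂ (proj₂ log4-bound))
          J = (J₁ ℕ.⊔ J₂) ℕ.⊔ (J₃ ℕ.⊔ J₄)
          module _ (j : ℕ) (J≤j : J ℕ.≤ j) where
            J₁≤j = ℕ.m⊔n≤o⇒m≤o J₁ J₂ (ℕ.m⊔n≤o⇒m≤o (J₁ ℕ.⊔ J₂) (J₃ ℕ.⊔ J₄) J≤j)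
            J₂≤j = ℕ.m⊔n≤o⇒n≤o J₁ J₂ (ℕ.m⊔n≤o⇒m≤o (J₁ ℕ.⊔ J₂) (J₃ ℕ.⊔ J₄) J≤j)
            J₃≤j = ℕ.m⊔n≤o⇒m≤o J₃ J₄ (ℕ.m⊔n≤o⇒n≤o (J₁ ℕ.⊔ J₂) (J₃ ℕ.⊔ J₄) J≤j)
            J₄≤j = ℕ.m⊔n≤o⇒n≤o J₃ J₄ (ℕ.m⊔n≤o⇒n≤o (J₁ ℕ.⊔ J₂) (J₃ ℕ.⊔ J₄) J≤j)
            X = logSum (T m) j
            Y = logSum (T n) j
            prod = logSum-* (T n ℕ.^ (m ℕ.* E)) (4 ℕ.^ (m ℕ.* n)) {{ℕ.m^n≢0 4 (m ℕ.* n)}} j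
            i = proj₁ prod
            j≤i = proj₁ (proj₂ prod)
            w = inv m ℚ.* inv n ℚ.* inv E
            0≤w : ℚ.NonNegative w
            0≤w = ℚ.nonNeg*nonNeg⇒nonNeg (inv m ℚ.* inv n)
                    {{ℚ.nonNeg*nonNeg⇒nonNeg (inv m) {{inv-nonNeg m}} (inv n) {{inv-nonNeg n}}}}
                    (inv E) {{inv-nonNeg E}}
            scaled : ι (n ℕ.* E) ℚ.* (X ℚ.- δ) ℚ.≤ ι (m ℕ.* E) ℚ.* (Y ℚ.+ δ ℚ.+ δ) ℚ.+ ι (m ℕ.* n) ℚ.* B
            scaled = begin
              ι (n ℕ.* E) ℚ.* (X ℚ.- δ)                           ≤⟨ proj₂ (proj₂ powm (n ℕ.* E) j J₁≤j) ⟩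
              logSum (T m ℕ.^ (n ℕ.* E)) j                        ≤⟨ logSum-mono j (proj₂ (rates E) m n N≤m N≤n) ⟩
              logSum (T n ℕ.^ (m ℕ.* E) ℕ.* 4 ℕ.^ (m ℕ.* n)) j    ≡⟨ proj₂ (proj₂ prod) ⟩
              logSum (T n ℕ.^ (m ℕ.* E)) i ℚ.+ logSum (4 ℕ.^ (m ℕ.* n)) j
                ≤⟨ ℚ.+-mono-≤ (proj₁ (proj₂ pown (m ℕ.* E) i (ℕ.≤-trans J₂≤j j≤i)))
                              (proj₂ (proj₂ (proj₂ log4-bound)) (m ℕ.* n) j J₄≤j) ⟩
              ι (m ℕ.* E) ℚ.* (logSum (T n) i ℚ.+ δ) ℚ.+ ι (m ℕ.* n) ℚ.* B
                ≤⟨ ℚ.+-monoˡ-≤ (ι (m ℕ.* n) ℚ.* B) (ℚ.*-monoˡ-≤-nonNeg (ι (m ℕ.* E)) {{ℚ.nonNegative (0≤ι (m ℕ.* E))}}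
                     (ℚ.+-monoˡ-≤ δ (proj₂ stan i j (ℕ.≤-trans J₃≤j j≤i) J₃≤j))) ⟩
              ι (m ℕ.* E) ℚ.* (Y ℚ.+ δ ℚ.+ δ) ℚ.+ ι (m ℕ.* n) ℚ.* B  ∎
            cancel : ∀ k l o .{{_ : NonZero k}} .{{_ : NonZero l}} .{{_ : NonZero o}} p →
                     ι (k ℕ.* l) ℚ.* p ℚ.* (inv k ℚ.* inv l ℚ.* inv o) ≡ p ℚ.* inv o
            cancel k l o p = trans (cong (λ t → t ℚ.* p ℚ.* (inv k ℚ.* inv l ℚ.* inv o)) (ι-* k l))
              (trans (solve 6 (λ a b p u v w → a :* b :* p :* (u :* v :* w) := (a :* u) :* (b :* v) :* (p :* w)) refl
                        (ι k) (ι l) p (inv k) (inv l) (inv o))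
              (trans (cong₂ (λ s t → s ℚ.* t ℚ.* (p ℚ.* inv o)) (ι-inv k) (ι-inv l)) (ℚ.*-identityˡ (p ℚ.* inv o))))
            unscaled : (X ℚ.- δ) ℚ.* inv m ℚ.≤ (Y ℚ.+ δ ℚ.+ δ) ℚ.* inv n ℚ.+ B ℚ.* inv E
            unscaled = begin
              (X ℚ.- δ) ℚ.* inv m                                        ≡⟨ cancel n E m (X ℚ.- δ) ⟨
              ι (n ℕ.* E) ℚ.* (X ℚ.- δ) ℚ.* (inv n ℚ.* inv E ℚ.* inv m)  ≡⟨ cong (ι (n ℕ.* E) ℚ.* (X ℚ.- δ) ℚ.*_)
                                                                              (solve 3 (λ a b c → b :* c :* a := a :* b :* c) refl (inv m) (inv n) (inv E)) ⟩
              ι (n ℕ.* E) ℚ.* (X ℚ.- δ) ℚ.* w                            ≤⟨ ℚ.*-monoʳ-≤-nonNeg w {{0≤w}} scaled ⟩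
              (ι (m ℕ.* E) ℚ.* (Y ℚ.+ δ ℚ.+ δ) ℚ.+ ι (m ℕ.* n) ℚ.* B) ℚ.* w
                ≡⟨ solve 5 (λ p q a b c → (p :+ q) :* (a :* b :* c) := p :* (a :* c :* b) :+ q :* (a :* b :* c)) refl
                     (ι (m ℕ.* E) ℚ.* (Y ℚ.+ δ ℚ.+ δ)) (ι (m ℕ.* n) ℚ.* B) (inv m) (inv n) (inv E) ⟩
              ι (m ℕ.* E) ℚ.* (Y ℚ.+ δ ℚ.+ δ) ℚ.* (inv m ℚ.* inv E ℚ.* inv n) ℚ.+ ι (m ℕ.* n) ℚ.* B ℚ.* w
                ≡⟨ cong₂ ℚ._+_ (cancel m E n (Y ℚ.+ δ ℚ.+ δ)) (cancel m n E B) ⟩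
              (Y ℚ.+ δ ℚ.+ δ) ℚ.* inv n ℚ.+ B ℚ.* inv E                  ∎
            final : X ℚ.* inv m ℚ.≤ Y ℚ.* inv n ℚ.+ ε
            final = begin
              X ℚ.* inv m
                ≡⟨ solve 3 (λ x d u → x :* u := (x :- d) :* u :+ u :* d) refl X δ (inv m) ⟩
              (X ℚ.- δ) ℚ.* inv m ℚ.+ inv m ℚ.* δ
                ≤⟨ ℚ.+-mono-≤ unscaled (inv*δ≤δ m) ⟩
              (Y ℚ.+ δ ℚ.+ δ) ℚ.* inv n ℚ.+ B ℚ.* inv E ℚ.+ δ
                ≡⟨ solve 4 (λ y d v b → (y :+ d :+ d) :* v :+ b :+ d := y :* v :+ (v :* d :+ v :* d :+ b :+ d)) refl
                     Y δ (inv n) (B ℚ.* inv E) ⟩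
              Y ℚ.* inv n ℚ.+ (inv n ℚ.* δ ℚ.+ inv n ℚ.* δ ℚ.+ B ℚ.* inv E ℚ.+ δ)
                ≤⟨ ℚ.+-monoʳ-≤ (Y ℚ.* inv n) (ℚ.+-monoˡ-≤ δ (ℚ.+-mono-≤ (ℚ.+-mono-≤ (inv*δ≤δ n) (inv*δ≤δ n))
                     (proj₂ E-ok E (ℕ.n≤1+n _)))) ⟩
              Y ℚ.* inv n ℚ.+ (δ ℚ.+ δ ℚ.+ δ ℚ.+ δ)
                ≡⟨ cong (Y ℚ.* inv n ℚ.+_) (quarters ε) ⟩
              Y ℚ.* inv n ℚ.+ ε ∎

    growth-rate : Σ[ s ∈ ℝ ] ((λ n → log (T n) ÷ n) ⟶ s)
    growth-rate = complete (λ n → log (T n) ÷ n) rates-close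

-- Boxes

infix 4 _≟ᴮ_ _∈?_

_≟ᴮ_ : DecidableEquality Box
box x y z m n ≟ᴮ box x′ y′ z′ m′ n′ =
  map′ (λ { (refl , refl , refl , refl , refl) → refl }) (λ { refl → refl , refl , refl , refl , refl })
    (x ℤ.≟ x′ ×-dec y ℤ.≟ y′ ×-dec z ℤ.≟ z′ ×-dec m ℕ.≟ m′ ×-dec n ℕ.≟ n′)

_∈?_ : ∀ A X → Dec (A ∈ X)
A ∈? X = any? (A ≟ᴮ_) X

IntervalsMeet? : ∀ p m q n → Dec (IntervalsMeet p m q n)
IntervalsMeet? p m q n = p ℤ.<? q ℤ.+ + n ×-dec q ℤ.<? p ℤ.+ + m

ProjectionsMeet? : ∀ A B → Dec (ProjectionsMeet A B)
ProjectionsMeet? A B = IntervalsMeet? (x A) (dx A) (x B) (dx B) ×-dec IntervalsMeet? (y A) (dy A) (y B) (dy B)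

InteriorsDisjoint? : ∀ A B → Dec (InteriorsDisjoint A B)
InteriorsDisjoint? A B = ¬? (ProjectionsMeet? A B ×-dec IntervalsMeet? (z A) 1 (z B) 1)

Attached? : ∀ A B → Dec (Attached A B)
Attached? A B = (z B ℤ.≟ z A ℤ.+ 1ℤ ⊎-dec z A ℤ.≟ z B ℤ.+ 1ℤ) ×-dec ProjectionsMeet? A B

ProjectionsMeet-sym : ∀ {A B} → ProjectionsMeet A B → ProjectionsMeet B A
ProjectionsMeet-sym (p , q) = swap p , swap q

InteriorsDisjoint-sym : ∀ {A B} → InteriorsDisjoint A B → InteriorsDisjoint B A
InteriorsDisjoint-sym {A} {B} d (p , q) = d (ProjectionsMeet-sym {B} {A} p , swap q)

Attached-sym : ∀ {A B} → Attached A B → Attached B A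
Attached-sym {A} {B} (p , q) = Sum.swap p , ProjectionsMeet-sym {A} {B} q

p<p+n : ∀ p {n} → 0 ℕ.< n → p ℤ.< p ℤ.+ + n
p<p+n p {n} 0<n = subst (ℤ._< p ℤ.+ + n) (ℤ.+-identityʳ p) (ℤ.+-monoʳ-< p (ℤ.+<+ 0<n))

IntervalsMeet-self : ∀ p {m n} → 0 ℕ.< m → 0 ℕ.< n → IntervalsMeet p m p n
IntervalsMeet-self p 0<m 0<n = p<p+n p 0<n , p<p+n p 0<m

z<⇒disjoint : ∀ {A B} → z A ℤ.< z B → InteriorsDisjoint A B
z<⇒disjoint {A} {B} zA<zB (_ , _ , zB<zA+1) =
  ℤ.<⇒≱ zB<zA+1 (subst (ℤ._≤ z B) (ℤ.+-comm 1ℤ (z A)) (ℤ.i<j⇒suc[i]≤j zA<zB))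

private
  swap-last : ∀ p q r → p ℤ.+ q ℤ.+ r ≡ p ℤ.+ r ℤ.+ q
  swap-last = ℤ-solve-∀

  +-cancel : ∀ p a → p ℤ.+ a ℤ.+ ℤ.- a ≡ p
  +-cancel = ℤ-solve-∀

+-monoˡ-<-shift : ∀ a {p q n} → p ℤ.< q ℤ.+ + n → p ℤ.+ a ℤ.< q ℤ.+ a ℤ.+ + n
+-monoˡ-<-shift a {p} {q} {n} lt = subst (p ℤ.+ a ℤ.<_) (swap-last q (+ n) a) (ℤ.+-monoˡ-< a lt)

IntervalsMeet-+ : ∀ a {p m q n} → IntervalsMeet p m q n → IntervalsMeet (p ℤ.+ a) m (q ℤ.+ a) n
IntervalsMeet-+ a {p} {m} {q} {n} (l , r) = +-monoˡ-<-shift a {p} {q} {n} l , +-monoˡ-<-shift a {q} {p} {m} r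

ProjectionsMeet-translate : ∀ v {A B} → ProjectionsMeet A B → ProjectionsMeet (translate v A) (translate v B)
ProjectionsMeet-translate (a , b , c) {A} {B} (p , q) =
  IntervalsMeet-+ a {x A} {dx A} {x B} {dx B} p , IntervalsMeet-+ b {y A} {dy A} {y B} {dy B} q

Attached-translate : ∀ v {A B} → Attached A B → Attached (translate v A) (translate v B)
Attached-translate v@(_ , _ , c) {A} {B} (levels , meet) =
  Sum.map (shiftᶻ (z A) (z B)) (shiftᶻ (z B) (z A)) levels , ProjectionsMeet-translate v {A} {B} meet
  where
  shiftᶻ : ∀ p q → q ≡ p ℤ.+ 1ℤ → q ℤ.+ c ≡ p ℤ.+ c ℤ.+ 1ℤ
  shiftᶻ p q eq = trans (cong (ℤ._+ c) eq) (swap-last p 1ℤ c)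

negᵛ : Vector → Vector
negᵛ (a , b , c) = ℤ.- a , ℤ.- b , ℤ.- c

box-cong : ∀ {x x′ y y′ z z′ m n} → x ≡ x′ → y ≡ y′ → z ≡ z′ → box x y z m n ≡ box x′ y′ z′ m n
box-cong refl refl refl = refl

translate-neg : ∀ v A → translate (negᵛ v) (translate v A) ≡ A
translate-neg (a , b , c) (box x y z _ _) = box-cong (+-cancel x a) (+-cancel y b) (+-cancel z c)

-- Disjointness is a negation, so an overlap of the images is translated back by `negᵛ v`.
InteriorsDisjoint-translate : ∀ v {A B} → InteriorsDisjoint A B → InteriorsDisjoint (translate v A) (translate v B)
InteriorsDisjoint-translate v@(_ , _ , c) {A} {B} disj (meet , levels) = transport disj (translate-neg v A) (translate-neg v B)
  (ProjectionsMeet-translate (negᵛ v) {translate v A} {translate v B} meet ,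
    IntervalsMeet-+ (ℤ.- c) {z A ℤ.+ c} {1} {z B ℤ.+ c} {1} levels)
  where
  transport : InteriorsDisjoint A B → ∀ {A′ B′} → A′ ≡ A → B′ ≡ B → InteriorsDisjoint A′ B′
  transport d refl refl = d

-- Paths inside a list of boxes

Adj : List Box → Box → Box → Set
Adj X C D = C ∈ X × D ∈ X × Attached C D

Adj-mono : ∀ {X Y} → X ⊆ Y → ∀ {A B} → Star (Adj X) A B → Star (Adj Y) A B
Adj-mono X⊆Y = Star.map λ (p , q , r) → X⊆Y p , X⊆Y q , r

Adj-sym : ∀ {X A B} → Adj X A B → Adj X B A
Adj-sym {_} {A} {B} (p , q , r) = q , p , Attached-sym {A} {B} r

Rooted : List Box → Box → Set
Rooted X r = ∀ {A} → A ∈ X → Star (Adj X) A r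

Rooted⇒Contiguous : ∀ {X r} → Rooted X r → Contiguous X
Rooted⇒Contiguous {X} rooted A∈ B∈ = rooted A∈ ◅◅ Star.reverse (λ {A} {B} → Adj-sym {X} {A} {B}) (rooted B∈)

Contiguous-resp : ∀ {X Y} → X ⊆ Y → Y ⊆ X → Contiguous X → Contiguous Y
Contiguous-resp X⊆Y Y⊆X cont A∈ B∈ = Adj-mono X⊆Y (cont (Y⊆X A∈) (Y⊆X B∈))

Contiguous-translate : ∀ v {X} → Contiguous X → Contiguous (map (translate v) X)
Contiguous-translate v {X} cont A∈ B∈ with ∈-map⁻ (translate v) A∈ | ∈-map⁻ (translate v) B∈
... | A , A∈X , refl | B , B∈X , refl =
  Star.gmap (translate v) (λ {C} {D} (p , q , r) → ∈-map⁺ (translate v) p , ∈-map⁺ (translate v) q , Attached-translate v {C} {D} r)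
    (cont A∈X B∈X)

-- A spanning tree written as a list: every box but the last is attached to a later one, so the head
-- is always a leaf.
data Grown : List Box → Set where
  [_]    : ∀ A → Grown (A ∷ [])
  attach : ∀ {A B rs} → B ∈ rs → Attached A B → Grown rs → Grown (A ∷ rs)

-- A connected set of boxes contracted to the vertex r of a tree; `All Cluster rs` with `Grown rs`
-- is a tree of such contracted vertices.
record Cluster (r : Box) : Set where
  field
    others : List Box
    rooted : Rooted (r ∷ others) r

  members : List Box
  members = r ∷ others

open Cluster

singleton : ∀ r → Cluster r
singleton r = record { others = [] ; rooted = λ { (here refl) → Star.ε } }

flatten : ∀ {rs} → All Cluster rs → List Box
flatten []       = []
flatten (c ∷ cs) = members c ++ flatten cs

root∈flatten : ∀ {rs} (cs : All Cluster rs) → rs ⊆ flatten cs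
root∈flatten (c ∷ cs) (here refl) = here refl
root∈flatten (c ∷ cs) (there p)   = ∈-++⁺ʳ (members c) (root∈flatten cs p)

flatten-rooted : ∀ {rs} → Grown rs → (cs : All Cluster rs) → ∃[ r ] Rooted (flatten cs) r
flatten-rooted [ A ] (c ∷ []) = A , subst (λ X → Rooted X A) (sym (++-identityʳ (members c))) (rooted c)
flatten-rooted (attach {A} B∈ att g) (c ∷ cs) with flatten-rooted g cs
... | r , rooted′ = r , λ p → [ left , right ]′ (∈-++⁻ (members c) p)
  where
  right : ∀ {C} → C ∈ flatten cs → Star (Adj (flatten (c ∷ cs))) C r
  right q = Adj-mono (∈-++⁺ʳ (members c)) (rooted′ q)
  left : ∀ {C} → C ∈ members c → Star (Adj (flatten (c ∷ cs))) C r
  left q = Adj-mono ∈-++⁺ˡ (rooted c q) ◅◅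
    ((here refl , ∈-++⁺ʳ (members c) (root∈flatten cs B∈) , att) ◅ right (root∈flatten cs B∈))

flatten-contiguous : ∀ {rs} → Grown rs → (cs : All Cluster rs) → Contiguous (flatten cs)
flatten-contiguous g cs = Rooted⇒Contiguous (proj₂ (flatten-rooted g cs))

singletons : ∀ rs → All Cluster rs
singletons []       = []
singletons (r ∷ rs) = singleton r ∷ singletons rs

flatten-singletons : ∀ rs → flatten (singletons rs) ≡ rs
flatten-singletons []       = refl
flatten-singletons (r ∷ rs) = cong (r ∷_) (flatten-singletons rs)

Grown⇒Contiguous : ∀ {rs} → Grown rs → Contiguous rs
Grown⇒Contiguous {rs} g = subst Contiguous (flatten-singletons rs) (flatten-contiguous g (singletons rs))

elsewhere : ∀ {r rs} → r ∈ rs → All Cluster rs → List Box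
elsewhere (here refl) (c ∷ cs) = flatten cs
elsewhere (there i)   (c ∷ cs) = members c ++ elsewhere i cs

flatten-lookup : ∀ {r rs} (i : r ∈ rs) (cs : All Cluster rs) →
  flatten cs ↭ members (All.lookup cs i) ++ elsewhere i cs
flatten-lookup (here refl) (c ∷ cs) = ↭-refl
flatten-lookup (there i)   (c ∷ cs) = ↭-trans (++⁺ˡ (members c) (flatten-lookup i cs))
  (shifts (members c) (members (All.lookup cs i)))

flatten-≔ : ∀ {r rs} (i : r ∈ rs) (cs : All Cluster rs) c →
  flatten (cs [ i ]≔ c) ↭ members c ++ elsewhere i cs
flatten-≔ (here refl) (_ ∷ cs) c = ↭-refl
flatten-≔ (there i)   (d ∷ cs) c = ↭-trans (++⁺ˡ (members d) (flatten-≔ i cs c))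
  (shifts (members d) (members c))

-- Cutting a spanning tree at a block

module _ (N : ℕ) where

  Small : ∀ {rs} → All Cluster rs → Set
  Small []       = ⊤
  Small (c ∷ cs) = length (members c) ℕ.< N × Small cs

  Small-lookup : ∀ {r rs} (i : r ∈ rs) (cs : All Cluster rs) → Small cs → length (members (All.lookup cs i)) ℕ.< N
  Small-lookup (here refl) (c ∷ cs) (p , _) = p
  Small-lookup (there i)   (c ∷ cs) (_ , s) = Small-lookup i cs s

  Small-≔ : ∀ {r rs} (i : r ∈ rs) (cs : All Cluster rs) c → length (members c) ℕ.< N → Small cs → Small (cs [ i ]≔ c)
  Small-≔ (here refl) (_ ∷ cs) c p (_ , s) = p , s
  Small-≔ (there i)   (_ ∷ cs) c p (q , s) = q , Small-≔ i cs c p s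

  Small-singletons : 2 ℕ.≤ N → ∀ rs → Small (singletons rs)
  Small-singletons 2≤N []       = tt
  Small-singletons 2≤N (r ∷ rs) = 2≤N , Small-singletons 2≤N rs

  -- `left` and `right` omit the shared box, so that `perm` lists each box once. The size of the
  -- right part follows from the total.
  record Split (X : List Box) : Set where
    field
      shared       : Box
      left right   : List Box
      perm         : shared ∷ left ++ right ↭ X
      left-cont    : Contiguous (shared ∷ left)
      right-cont   : Contiguous (shared ∷ right)
      left-lower   : N ℕ.≤ length (shared ∷ left)
      left-upper   : length (shared ∷ left) ℕ.< 2 ℕ.* N

  merge : ∀ {A B} → Attached A B → Cluster A → Cluster B → Cluster B
  merge {A} {B} att c d = record
    { others = members c ++ others d
    ; rooted = λ
        { (here refl) → Star.ε
        ; (there p)   →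
            [ (λ q → Adj-mono (there ∘ ∈-++⁺ˡ) (rooted c q) ◅◅ ((there (here refl) , here refl , att) ◅ Star.ε))
            , (λ q → Adj-mono ⊆-merge (rooted d (there q))) ]′ (∈-++⁻ (members c) p)
        }
    }
    where
    ⊆-merge : members d ⊆ B ∷ members c ++ others d
    ⊆-merge (here refl) = here refl
    ⊆-merge (there q)   = there (∈-++⁺ʳ (members c) q)

  merge-↭ : ∀ {A B rs} (att : Attached A B) (i : B ∈ rs) (c : Cluster A) (cs : All Cluster rs) →
    members (merge att c (All.lookup cs i)) ++ elsewhere i cs ↭ members c ++ flatten cs
  merge-↭ {B = B} att i c cs = begin
    B ∷ (members c ++ others d) ++ elsewhere i cs   ≡⟨ cong (B ∷_) (++-assoc (members c) (others d) (elsewhere i cs)) ⟩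
    B ∷ members c ++ others d ++ elsewhere i cs     ↭⟨ shift B (members c) (others d ++ elsewhere i cs) ⟨
    members c ++ B ∷ others d ++ elsewhere i cs     ↭⟨ ++⁺ˡ (members c) (flatten-lookup i cs) ⟨
    members c ++ flatten cs                         ∎
    where
    open PermutationReasoning
    d = All.lookup cs i

  -- The cluster of the first root is merged into that of the root it is attached to, until a merged
  -- cluster reaches size N; sharing the root B keeps the other boxes connected.
  split : ∀ {rs} → Grown rs → (cs : All Cluster rs) → Small cs → N ℕ.≤ length (flatten cs) → Split (flatten cs)
  split [ A ] (c ∷ []) (small , _) N≤ =
    contradiction (subst (λ X → N ℕ.≤ length X) (++-identityʳ (members c)) N≤) (ℕ.<⇒≱ small)
  split (attach {A} {B} i att g) (c ∷ cs) (small , smalls) N≤ with N ℕ.≤? length (members (merge att c (All.lookup cs i)))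
  ... | yes N≤e = record
    { shared     = B
    ; left       = others e
    ; right      = elsewhere i cs
    ; perm       = merge-↭ att i c cs
    ; left-cont  = Rooted⇒Contiguous (rooted e)
    -- Reducing the cluster of B to B alone takes away the left part but leaves the tree of the
    -- roots intact, so the rest stays connected.
    ; right-cont = Contiguous-resp (∈-resp-↭ σ) (∈-resp-↭ (↭-sym σ)) (flatten-contiguous g (cs [ i ]≔ singleton B))
    ; left-lower = N≤e
    -- Both clusters had fewer than N boxes before they were merged.
    ; left-upper = subst (ℕ._< 2 ℕ.* N) (sym weight-e)
                     (subst (weight c ℕ.+ weight d ℕ.<_) (cong (N ℕ.+_) (sym (ℕ.+-identityʳ N))) (ℕ.+-mono-< small (Small-lookup i cs smalls)))
    }
    where
    weight : ∀ {r} → Cluster r → ℕ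
    weight c = length (members c)
    d = All.lookup cs i
    e = merge att c d
    σ = flatten-≔ i cs (singleton B)
    weight-e : weight e ≡ weight c ℕ.+ weight d
    weight-e = trans (cong suc (length-++ (members c))) (sym (ℕ.+-suc (weight c) (length (others d))))
  ... | no N≰e = record
    { shared     = shared
    ; left       = left
    ; right      = right
    ; perm       = ↭-trans perm merged
    ; left-cont  = left-cont
    ; right-cont = right-cont
    ; left-lower = left-lower
    ; left-upper = left-upper
    }
    where
    d = All.lookup cs i
    e = merge att c d
    merged : flatten (cs [ i ]≔ e) ↭ members c ++ flatten cs
    merged = ↭-trans (flatten-≔ i cs e) (merge-↭ att i c cs)
    open Split (split g (cs [ i ]≔ e) (Small-≔ i cs e (ℕ.≰⇒> N≰e) smalls)
                 (subst (N ℕ.≤_) (sym (↭-length merged)) N≤))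

  split-grown : 2 ℕ.≤ N → ∀ {X} → Grown X → N ℕ.≤ length X → Split X
  split-grown 2≤N {X} g N≤ = subst Split (flatten-singletons X)
    (split g (singletons X) (Small-singletons 2≤N X) (subst (λ Y → N ℕ.≤ length Y) (sym (flatten-singletons X)) N≤))

first-exit : ∀ {X Y A B} → Star (Adj X) A B → A ∈ Y → B ∉ Y →
  ∃[ C ] ∃[ D ] (C ∈ Y × D ∈ X × D ∉ Y × Attached D C)
first-exit Star.ε A∈Y B∉Y = contradiction A∈Y B∉Y
first-exit {Y = Y} (_◅_ {A} {C} (_ , C∈X , att) path) A∈Y B∉Y with C ∈? Y
... | yes C∈Y = first-exit path C∈Y B∉Y
... | no  C∉Y = A , C , A∈Y , C∈X , C∉Y , Attached-sym {A} {C} att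

-- Greedy growth from A: while Y misses a box of X, a path to that box leaves Y, and its first box
-- outside Y can be attached. The counter d is the number of missing boxes.
grown-order : ∀ {X A} → Unique X → Contiguous X → A ∈ X → ∃[ Y ] (Grown Y × Unique Y × Y ⊆ X × length Y ≡ length X)
grown-order {X} {A} uX cont A∈X = extend (length X ℕ.∸ 1) (A ∷ []) (here refl)
    (ℕ.m∸n+n≡m (nonempty A∈X)) [ A ] ([] ∷ []) λ { (here refl) → A∈X }
  where
  nonempty : ∀ {X : List Box} → A ∈ X → 1 ℕ.≤ length X
  nonempty (here _)  = s≤s z≤n
  nonempty (there _) = s≤s z≤n
  extend : ∀ d Y → A ∈ Y → d ℕ.+ length Y ≡ length X → Grown Y → Unique Y → Y ⊆ X →
    ∃[ Y ] (Grown Y × Unique Y × Y ⊆ X × length Y ≡ length X)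
  extend zero    Y A∈Y len g uY Y⊆X = Y , g , uY , Y⊆X , len
  extend (suc d) Y A∈Y len g uY Y⊆X with All.all? (_∈? Y) X
  ... | yes X⊆Y = contradiction (ℕ.≤-trans (s≤s (ℕ.m≤n+m (length Y) d)) (ℕ.≤-reflexive len))
                    (ℕ.≤⇒≯ (Unique-⊆⇒length-≤ uX (All.lookup X⊆Y)))
  ... | no  X⊈Y with find (¬All⇒Any¬ (_∈? Y) X X⊈Y)
  ... | B , B∈X , B∉Y with first-exit (cont A∈X B∈X) A∈Y B∉Y
  ... | C , D , C∈Y , D∈X , D∉Y , att = extend d (D ∷ Y) (there A∈Y) (trans (ℕ.+-suc d (length Y)) len)
    (attach C∈Y att g) (¬Any⇒All¬ Y D∉Y ∷ uY) λ { (here refl) → D∈X ; (there p) → Y⊆X p }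

-- Moves

infixl 6 _⊕_

_⊕_ : Vector → Vector → Vector
(a , b , c) ⊕ (a′ , b′ , c′) = a ℤ.+ a′ , b ℤ.+ b′ , c ℤ.+ c′

rotateᵛ : Vector → Vector
rotateᵛ (a , b , c) = ℤ.- b , a , c

turnᵛ : ℕ → Vector → Vector
turnᵛ zero    v = v
turnᵛ (suc k) v = rotateᵛ (turnᵛ k v)

translate-⊕ : ∀ u v A → translate u (translate v A) ≡ translate (v ⊕ u) A
translate-⊕ (a , b , c) (a′ , b′ , c′) (box x y z _ _) =
  box-cong (ℤ.+-assoc x a′ a) (ℤ.+-assoc y b′ b) (ℤ.+-assoc z c′ c)

turn-translate : ∀ k v A → turn k (translate v A) ≡ translate (turnᵛ k v) (turn k A)
turn-translate zero    v A = refl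
turn-translate (suc k) v A = trans (cong rotate (turn-translate k v A)) (rotate-translate (turnᵛ k v) (turn k A))
  where
  lemma : ∀ p q r → ℤ.- ((p ℤ.+ q) ℤ.+ r) ≡ ℤ.- (p ℤ.+ r) ℤ.+ ℤ.- q
  lemma = ℤ-solve-∀
  rotate-translate : ∀ v A → rotate (translate v A) ≡ translate (rotateᵛ v) (rotate A)
  rotate-translate (a , b , c) (box x y z dx dy) = box-cong (lemma y b (+ dy)) refl refl

turn-+ : ∀ j k A → turn j (turn k A) ≡ turn (j ℕ.+ k) A
turn-+ zero    k A = refl
turn-+ (suc j) k A = cong rotate (turn-+ j k A)

turn-4* : ∀ k A → turn (k ℕ.* 4) A ≡ A
turn-4* zero    A = refl
turn-4* (suc k) A = trans (turn-4 (turn (k ℕ.* 4) A)) (turn-4* k A)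
  where
  lemma : ∀ p q → ℤ.- (ℤ.- (p ℤ.+ q) ℤ.+ q) ≡ p
  lemma = ℤ-solve-∀
  turn-4 : ∀ A → turn 4 A ≡ A
  turn-4 (box x y z dx dy) = box-cong (lemma x (+ dx)) (lemma y (+ dy)) refl

turn-% : ∀ k A → turn k A ≡ turn (k % 4) A
turn-% k A = begin
  turn k A                              ≡⟨ cong (λ i → turn i A) (m≡m%n+[m/n]*n k 4) ⟩
  turn (k % 4 ℕ.+ k / 4 ℕ.* 4) A        ≡⟨ turn-+ (k % 4) (k / 4 ℕ.* 4) A ⟨
  turn (k % 4) (turn (k / 4 ℕ.* 4) A)   ≡⟨ cong (turn (k % 4)) (turn-4* (k / 4) A) ⟩
  turn (k % 4) A                        ∎
  where open ≡-Reasoning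

move-∘ : ∀ j u k v A → move j u (move k v A) ≡ move (j ℕ.+ k) (turnᵛ j v ⊕ u) A
move-∘ j u k v A = begin
  translate u (turn j (translate v (turn k A)))           ≡⟨ cong (translate u) (turn-translate j v (turn k A)) ⟩
  translate u (translate (turnᵛ j v) (turn j (turn k A))) ≡⟨ translate-⊕ u (turnᵛ j v) (turn j (turn k A)) ⟩
  translate (turnᵛ j v ⊕ u) (turn j (turn k A))           ≡⟨ cong (translate (turnᵛ j v ⊕ u)) (turn-+ j k A) ⟩
  translate (turnᵛ j v ⊕ u) (turn (j ℕ.+ k) A)            ∎
  where open ≡-Reasoning

-- k quarter turns are undone by 3 k further ones, since k * 4 quarter turns are the identity.
move-inverse : ∀ k v A → move (k ℕ.* 3) (turnᵛ (k ℕ.* 3) (negᵛ v)) (move k v A) ≡ A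
move-inverse k v A = begin
  translate (turnᵛ (k ℕ.* 3) (negᵛ v)) (turn (k ℕ.* 3) (move k v A))  ≡⟨ turn-translate (k ℕ.* 3) (negᵛ v) (move k v A) ⟨
  turn (k ℕ.* 3) (translate (negᵛ v) (move k v A))                    ≡⟨ cong (turn (k ℕ.* 3)) (translate-neg v (turn k A)) ⟩
  turn (k ℕ.* 3) (turn k A)                                           ≡⟨ turn-+ (k ℕ.* 3) k A ⟩
  turn (k ℕ.* 3 ℕ.+ k) A                                              ≡⟨ cong (λ i → turn i A) (trans (ℕ.+-comm (k ℕ.* 3) k) (sym (ℕ.*-suc k 3))) ⟩
  turn (k ℕ.* 4) A                                                    ≡⟨ turn-4* k A ⟩
  A                                                                   ∎
  where open ≡-Reasoning

move-injective : ∀ k v {A B} → move k v A ≡ move k v B → A ≡ B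
move-injective k v {A} {B} eq = trans (sym (move-inverse k v A))
  (trans (cong (move (k ℕ.* 3) (turnᵛ (k ℕ.* 3) (negᵛ v))) eq) (move-inverse k v B))

z-move : ∀ k v A → z (move k v A) ≡ z A ℤ.+ proj₂ (proj₂ v)
z-move k (a , b , c) A = cong (ℤ._+ c) (z-turn k)
  where
  z-turn : ∀ k → z (turn k A) ≡ z A
  z-turn zero    = refl
  z-turn (suc k) = z-turn k

diff : Box → Box → Vector
diff A B = x A ℤ.- x B , y A ℤ.- y B , z A ℤ.- z B

diff-translate : ∀ v A → diff (translate v A) A ≡ v
diff-translate (a , b , c) A = cong₂ _,_ (lemma (x A) a) (cong₂ _,_ (lemma (y A) b) (lemma (z A) c))
  where
  lemma : ∀ p q → p ℤ.+ q ℤ.- p ≡ q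
  lemma = ℤ-solve-∀

-- A move is determined by its rotation part modulo 4 and the image of one box.
align : ℕ → Box → Box → Box → Box
align k A B = move k (diff B (turn k A))

move≗align : ∀ k v A C → move k v C ≡ align (k % 4) A (move k v A) C
move≗align k v A C = cong₂ translate
  (trans (sym (diff-translate v (turn k A))) (cong (diff (move k v A)) (turn-% k A))) (turn-% k C)

module _ k v {X Y} (X∼Y : map (move k v) X ∼[ set ] Y) where

  image∈ : ∀ {A} → A ∈ X → move k v A ∈ Y
  image∈ A∈X = Equivalence.to X∼Y (∈-map⁺ (move k v) A∈X)

  preimage : ∀ {B} → B ∈ Y → ∃[ A ] (A ∈ X × B ≡ move k v A)
  preimage B∈Y = ∈-map⁻ (move k v) (Equivalence.from X∼Y B∈Y)

-- Enumerating the buildings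

module ∼ = Setoid ([ set ]-Equality Box)

∼set? : ∀ X Y → Dec (X ∼[ set ] Y)
∼set? X Y = map′ (λ (p , q) → ⊆-antisym (All.lookup p) (All.lookup q))
  (λ X∼Y → All.tabulate (Equivalence.to X∼Y) , All.tabulate (Equivalence.from X∼Y))
  (All.all? (_∈? Y) X ×-dec All.all? (_∈? X) Y)

-- Infinitely many moves reduce to a finite search: a rotation modulo 4 and the image of the first
-- box of X, which must lie in Y, determine the move.
Identified? : ∀ X Y → Dec (Identified X Y)
Identified? [] []      = yes (0 , (0ℤ , 0ℤ , 0ℤ) , ∼.refl)
Identified? [] (B ∷ Y) = no λ (_ , _ , X∼Y) → contradiction (Equivalence.from X∼Y (here refl)) λ ()
Identified? X@(A ∷ _) Y = map′ fromAligned toAligned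
  (any? (λ k → any? (λ B → ∼set? (map (align k A B) X) Y) Y) (upTo 4))
  where
  Aligned = Any (λ k → Any (λ B → map (align k A B) X ∼[ set ] Y) Y) (upTo 4)
  fromAligned : Aligned → Identified X Y
  fromAligned p with find p
  ... | k , _ , q with find q
  ... | B , _ , X∼Y = k , diff B (turn k A) , X∼Y
  toAligned : Identified X Y → Aligned
  toAligned (k , v , X∼Y) = lose (∈-upTo⁺ (m%n<n k 4)) (lose (image∈ k v X∼Y (here refl))
    (∼.trans (∼.reflexive (sym (map-cong (move≗align k v A) X))) X∼Y))

select : {A B : Set} {P : A → Set} → (∀ x → Dec (P x)) → (∀ x → P x → B) → List A → List B
select P? f []       = []
select P? f (x ∷ xs) with P? x
... | yes p = f x p ∷ select P? f xs
... | no  _ = select P? f xs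

-- The proof p found by `P?` need not be the given one, and the selected value may depend on it.
∈-select : {A B : Set} {P : A → Set} (P? : ∀ x → Dec (P x)) (f : ∀ x → P x → B) {xs : List A} {x : A} →
  x ∈ xs → P x → ∃[ p ] (f x p ∈ select P? f xs)
∈-select P? f {x ∷ xs} (here refl) px with P? x
... | yes p = p , here refl
... | no ¬p = contradiction px ¬p
∈-select P? f {y ∷ xs} (there x∈) px with P? y | ∈-select P? f x∈ px
... | yes _ | p , q = p , there q
... | no  _ | p , q = p , q

range : ℤ → ℕ → List ℤ
range a n = map (λ i → a ℤ.+ + i) (upTo n)

∈-range : ∀ a n {t} → a ℤ.≤ t → t ℤ.< a ℤ.+ + n → t ∈ range a n
∈-range a n {t} a≤t t<a+n = subst (_∈ range a n) eq (∈-map⁺ (λ i → a ℤ.+ + i) (∈-upTo⁺ i<n))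
  where
  i = ℤ.∣ t ℤ.- a ∣
  lemma : ∀ a t → a ℤ.+ (t ℤ.- a) ≡ t
  lemma = ℤ-solve-∀
  lemma′ : ∀ a n → a ℤ.+ n ℤ.- a ≡ n
  lemma′ = ℤ-solve-∀
  +i : + i ≡ t ℤ.- a
  +i = ℤ.0≤i⇒+∣i∣≡i (ℤ.i≤j⇒0≤j-i a≤t)
  eq : a ℤ.+ + i ≡ t
  eq = trans (cong (λ i → a ℤ.+ i) +i) (lemma a t)
  i<n : i ℕ.< n
  i<n = ℤ.drop‿+<+ (subst₂ ℤ._<_ (sym +i) (lemma′ a (+ n)) (ℤ.+-monoˡ-< (ℤ.- a) t<a+n))

-- The intervals meet only if q - m < p < q + n. The list also contains q - m; candidates are tested
-- again in `extensions`.
meeting : ℤ → ℕ → ℕ → List ℤ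
meeting q n m = range (q ℤ.- + m) (m ℕ.+ n)

∈-meeting : ∀ {p m q n} → IntervalsMeet p m q n → p ∈ meeting q n m
∈-meeting {p} {m} {q} {n} (p<q+n , q<p+m) = ∈-range (q ℤ.- + m) (m ℕ.+ n)
  (ℤ.<⇒≤ (subst (q ℤ.- + m ℤ.<_) (lemma p (+ m)) (ℤ.+-monoˡ-< (ℤ.- + m) q<p+m)))
  (subst (p ℤ.<_) (trans (lemma′ q (+ m) (+ n)) (cong (λ t → q ℤ.- + m ℤ.+ t) (sym (ℤ.pos-+ m n)))) p<q+n)
  where
  lemma : ∀ p m → p ℤ.+ m ℤ.- m ≡ p
  lemma = ℤ-solve-∀
  lemma′ : ∀ q m n → q ℤ.+ n ≡ q ℤ.- m ℤ.+ (m ℤ.+ n)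
  lemma′ = ℤ-solve-∀

module _ (b w : ℕ) where

  IsBlock? : ∀ A → Dec (IsBlock b w A)
  IsBlock? A = (dx A ℕ.≟ b ×-dec dy A ℕ.≟ w) ⊎-dec (dx A ℕ.≟ w ×-dec dy A ℕ.≟ b)

  oriented : Box → ℕ → ℕ → List Box
  oriented D m n =
      concatMap (λ s → concatMap (λ t → map (λ u → box s t u m n) levels) (meeting (y D) (dy D) n))
        (meeting (x D) (dx D) m)
    where
    levels = (z D ℤ.- 1ℤ) ∷ (z D ℤ.+ 1ℤ) ∷ []

  neighbours : Box → List Box
  neighbours D = oriented D b w ++ oriented D w b

  ∈-oriented : ∀ {C D} → Attached C D → C ∈ oriented D (dx C) (dy C)
  ∈-oriented {C} {D} (levels , meetˣ , meetʸ) =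
    ∈-concatMap⁺ _ (lose (∈-meeting meetˣ) (∈-concatMap⁺ _ (lose (∈-meeting meetʸ)
      (∈-map⁺ (λ u → box (x C) (y C) u (dx C) (dy C)) (zC∈ levels)))))
    where
    lemma : ∀ p → p ℤ.+ 1ℤ ℤ.- 1ℤ ≡ p
    lemma = ℤ-solve-∀
    zC∈ : z D ≡ z C ℤ.+ 1ℤ ⊎ z C ≡ z D ℤ.+ 1ℤ → z C ∈ (z D ℤ.- 1ℤ) ∷ (z D ℤ.+ 1ℤ) ∷ []
    zC∈ (inj₁ eq) = here (sym (trans (cong (ℤ._- 1ℤ) eq) (lemma (z C))))
    zC∈ (inj₂ eq) = there (here eq)

  ∈-neighbours : ∀ {C D} → IsBlock b w C → Attached C D → C ∈ neighbours D
  ∈-neighbours {C} {D} (inj₁ (p , q)) att = ∈-++⁺ˡ (subst₂ (λ m n → C ∈ oriented D m n) p q (∈-oriented {C} {D} att))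
  ∈-neighbours {C} {D} (inj₂ (p , q)) att = ∈-++⁺ʳ (oriented D b w) (subst₂ (λ m n → C ∈ oriented D m n) p q (∈-oriented {C} {D} att))

  IsBlock-translate : ∀ v {A} → IsBlock b w A → IsBlock b w (translate v A)
  IsBlock-translate (_ , _ , _) p = p

  module _ .{{_ : NonZero b}} .{{_ : NonZero w}} where

    dims-pos : ∀ {A} → IsBlock b w A → 0 ℕ.< dx A × 0 ℕ.< dy A
    dims-pos (inj₁ (p , q)) = subst (0 ℕ.<_) (sym p) (ℕ.>-nonZero⁻¹ b) , subst (0 ℕ.<_) (sym q) (ℕ.>-nonZero⁻¹ w)
    dims-pos (inj₂ (p , q)) = subst (0 ℕ.<_) (sym p) (ℕ.>-nonZero⁻¹ w) , subst (0 ℕ.<_) (sym q) (ℕ.>-nonZero⁻¹ b)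

    -- A box of positive dimensions overlaps itself; this is where b and w must be positive.
    disjoint⇒≢ : ∀ {A B} → IsBlock b w A → InteriorsDisjoint A B → A ≢ B
    disjoint⇒≢ {A} isB disj refl = let 0<dx , 0<dy = dims-pos {A} isB in
      disj ((IntervalsMeet-self (x A) 0<dx 0<dx , IntervalsMeet-self (y A) 0<dy 0<dy) , IntervalsMeet-self (z A) (s≤s z≤n) (s≤s z≤n))

    module _ {n} (X : Building b w n) where

      unique : Unique (blocks X)
      unique = go (areBlocks X) (disjoint X)
        where
        go : ∀ {Y} → All (IsBlock b w) Y → AllPairs InteriorsDisjoint Y → Unique Y
        go []       []       = []
        go (p ∷ ps) (d ∷ ds) = All.map (disjoint⇒≢ p) d ∷ go ps ds

      isBlock : ∀ {A} → A ∈ blocks X → IsBlock b w A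
      isBlock = All.lookup (areBlocks X)

      separate : ∀ {A B} → A ∈ blocks X → B ∈ blocks X → A ≢ B → InteriorsDisjoint A B
      separate = AllPairs-lookup (λ {A} {B} → InteriorsDisjoint-sym {A} {B}) (disjoint X)

      subBuilding : ∀ {m Y} → Y ⊆ blocks X → Unique Y → Contiguous Y → length Y ≡ m → Building b w m
      subBuilding {Y = Y} Y⊆X uY cont len = record
        { blocks     = Y
        ; size       = len
        ; areBlocks  = All.tabulate (isBlock ∘ Y⊆X)
        ; disjoint   = AllPairs-tabulate uY λ p q → separate (Y⊆X p) (Y⊆X q)
        ; contiguous = cont
        }

      translated : Vector → Building b w n
      translated v = record
        { blocks     = map (translate v) (blocks X)
        ; size       = trans (length-map (translate v) (blocks X)) (size X)
        ; areBlocks  = All.tabulate λ p → case (∈-map⁻ (translate v) p)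
        ; disjoint   = translate-pairs (disjoint X)
        ; contiguous = Contiguous-translate v (contiguous X)
        }
        where
        case : ∀ {A} → ∃[ B ] (B ∈ blocks X × A ≡ translate v B) → IsBlock b w A
        case (B , B∈X , refl) = IsBlock-translate v {B} (isBlock B∈X)
        translate-all : ∀ {A Y} → All (InteriorsDisjoint A) Y → All (InteriorsDisjoint (translate v A)) (map (translate v) Y)
        translate-all [] = []
        translate-all {A} {B ∷ _} (d ∷ ds) = InteriorsDisjoint-translate v {A} {B} d ∷ translate-all {A} ds
        translate-pairs : ∀ {Y} → AllPairs InteriorsDisjoint Y → AllPairs InteriorsDisjoint (map (translate v) Y)
        translate-pairs [] = []
        translate-pairs {A ∷ _} (d ∷ ds) = translate-all {A} d ∷ translate-pairs ds

      grown : ∀ {m} → n ≡ suc m → ∃[ Y ] (Grown Y × Unique Y × Y ⊆ blocks X × length Y ≡ n)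
      grown n≡ with blocks X in eq | size X
      ... | []    | len = contradiction (trans len n≡) λ ()
      ... | A ∷ _ | len =
        let Y , g , uY , Y⊆X , len′ = grown-order (subst Unique eq unique)
              (λ {A} {B} → subst Contiguous eq (contiguous X) {A} {B}) (here refl)
        in Y , g , uY , Y⊆X , trans len′ len

    Extends : ∀ {n} → Building b w n → Box → Set
    Extends X C = IsBlock b w C × Any (Attached C) (blocks X) × All (InteriorsDisjoint C) (blocks X)

    Extends? : ∀ {n} (X : Building b w n) C → Dec (Extends X C)
    Extends? X C = IsBlock? C ×-dec any? (Attached? C) (blocks X) ×-dec All.all? (InteriorsDisjoint? C) (blocks X)

    extend : ∀ {n} (X : Building b w n) C → Extends X C → Building b w (suc n)
    extend X C (isB , att , disj) = record
      { blocks     = C ∷ blocks X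
      ; size       = cong suc (size X)
      ; areBlocks  = isB ∷ areBlocks X
      ; disjoint   = disj ∷ disjoint X
      ; contiguous = Rooted⇒Contiguous {r = D} λ
          { (here refl) → (here refl , there D∈X , C-D) ◅ Star.ε
          ; (there p)   → Adj-mono there (contiguous X p D∈X) }
      }
      where
      D = proj₁ (find att)
      D∈X = proj₁ (proj₂ (find att))
      C-D = proj₂ (proj₂ (find att))

    extensions : ∀ {n} → Building b w n → List (Building b w (suc n))
    extensions X = select (Extends? X) (extend X) (concatMap neighbours (blocks X))

    single : ∀ A → IsBlock b w A → Building b w 1
    single A isB = record
      { blocks     = A ∷ []
      ; size       = refl
      ; areBlocks  = isB ∷ []
      ; disjoint   = [] ∷ []
      ; contiguous = λ { (here refl) (here refl) → Star.ε }
      }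

    empty : Building b w 0
    empty = record { blocks = [] ; size = refl ; areBlocks = [] ; disjoint = [] ; contiguous = λ () }

    enumeration : ∀ n → List (Building b w n)
    enumeration 0             = empty ∷ []
    enumeration 1             = single (box 0ℤ 0ℤ 0ℤ b w) (inj₁ (refl , refl)) ∷
                                single (box 0ℤ 0ℤ 0ℤ w b) (inj₂ (refl , refl)) ∷ []
    enumeration (suc (suc n)) = concatMap extensions (enumeration (suc n))

    -- Rotations are not needed to reach every building from the enumerated ones.
    Covered : ∀ {n} → List Box → Building b w n → Set
    Covered X Y = ∃[ v ] (map (translate v) X ∼[ set ] blocks Y)

    module _ {n} (covered-n : ∀ (X : Building b w (suc n)) → Any (Covered (blocks X)) (enumeration (suc n))) where

      -- The head C of a growth order is a leaf, so the remaining boxes form a building, which a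
      -- translation v carries onto an enumerated Z. The translate of C is then among the extensions
      -- of Z.
      covered-step : ∀ (X : Building b w (suc (suc n))) → Any (Covered (blocks X)) (enumeration (suc (suc n)))
      covered-step X with grown X refl
      ... | C ∷ Y , attach {B = D} D∈Y C-D g , uC∷Y , C∷Y⊆X , len with find (covered-n Y-building)
        where
        Y-building : Building b w (suc n)
        Y-building = subBuilding X (C∷Y⊆X ∘ there) (proj₂ (Unique-++⁻ (C ∷ []) uC∷Y)) (Grown⇒Contiguous g) (ℕ.suc-injective len)
      ... | Z , Z∈ , v , Y∼Z =
        let C⁺ = translate v C
            p , ext∈ = ∈-select (Extends? Z) (extend Z)
              (∈-concatMap⁺ neighbours (lose D⁺∈Z (∈-neighbours {C⁺} {translate v D} isB att)))
              (isB , lose D⁺∈Z att , disj)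
        in lose (∈-concatMap⁺ extensions (lose Z∈ ext∈)) (v , ⊆-antisym to from)
        where
        D⁺∈Z : translate v D ∈ blocks Z
        D⁺∈Z = Equivalence.to Y∼Z (∈-map⁺ (translate v) D∈Y)
        C∈X = C∷Y⊆X (here refl)
        isB : IsBlock b w (translate v C)
        isB = IsBlock-translate v {C} (isBlock X C∈X)
        att : Attached (translate v C) (translate v D)
        att = Attached-translate v {C} {D} C-D
        X⊆C∷Y : blocks X ⊆ C ∷ Y
        X⊆C∷Y = Unique-⊆-full _≟ᴮ_ uC∷Y C∷Y⊆X (ℕ.≤-reflexive (trans (size X) (sym len)))
        disj : All (InteriorsDisjoint (translate v C)) (blocks Z)
        disj = All.tabulate λ {B} B∈Z → case (∈-map⁻ (translate v) (Equivalence.from Y∼Z B∈Z))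
          where
          case : ∀ {B} → ∃[ B′ ] (B′ ∈ Y × B ≡ translate v B′) → InteriorsDisjoint (translate v C) B
          case (B′ , B′∈Y , refl) = InteriorsDisjoint-translate v {C} {B′}
            (separate X C∈X (C∷Y⊆X (there B′∈Y)) λ { refl → Unique-∷⁻ uC∷Y B′∈Y })
        to : map (translate v) (blocks X) ⊆ translate v C ∷ blocks Z
        to A∈ with ∈-map⁻ (translate v) A∈
        ... | A , A∈X , refl with X⊆C∷Y A∈X
        ... | here refl = here refl
        ... | there A∈Y = there (Equivalence.to Y∼Z (∈-map⁺ (translate v) A∈Y))
        from : translate v C ∷ blocks Z ⊆ map (translate v) (blocks X)
        from (here refl) = ∈-map⁺ (translate v) C∈X
        from (there B∈Z) with ∈-map⁻ (translate v) (Equivalence.from Y∼Z B∈Z)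
        ... | B , B∈Y , refl = ∈-map⁺ (translate v) (C∷Y⊆X (there B∈Y))

    covered : ∀ n (X : Building b w n) → Any (Covered (blocks X)) (enumeration n)
    covered 0 X with blocks X | size X
    ... | [] | _ = here ((0ℤ , 0ℤ , 0ℤ) , ∼.refl)
    covered 1 X with blocks X | size X | areBlocks X
    ... | A ∷ [] | _ | inj₁ (refl , refl) ∷ [] = here (negᵛ (x A , y A , z A) ,
      ∼.reflexive (cong (_∷ []) (box-cong (ℤ.+-inverseʳ (x A)) (ℤ.+-inverseʳ (y A)) (ℤ.+-inverseʳ (z A)))))
    ... | A ∷ [] | _ | inj₂ (refl , refl) ∷ [] = there (here (negᵛ (x A , y A , z A) ,
      ∼.reflexive (cong (_∷ []) (box-cong (ℤ.+-inverseʳ (x A)) (ℤ.+-inverseʳ (y A)) (ℤ.+-inverseʳ (z A))))))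
    covered (suc (suc n)) = covered-step (covered (suc n))

    Covered⇒≈ : ∀ {n} (X Y : Building b w n) → Covered (blocks X) Y → Identified (blocks X) (blocks Y)
    Covered⇒≈ X Y (v , X∼Y) = 0 , v , X∼Y

    finite : ∀ n → ∃[ k ] HasCardinality (buildings b w n) k
    finite n = enumerated⇒finite (buildings b w n) (λ X Y → Identified? (blocks X) (blocks Y)) (enumeration n)
      λ X → Any.map (λ {Y} → Covered⇒≈ X Y) (covered n X)

-- Stacking two buildings

module Stacking where

  -- Applied with f = z to find a top block and with f = - z to find a bottom block.
  highest : (f : Box → ℤ) → ∀ A X → ∃[ M ] (M ∈ A ∷ X × (∀ {B} → B ∈ A ∷ X → f B ℤ.≤ f M))
  highest f A []      = A , here refl , λ { (here refl) → ℤ.≤-refl }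
  highest f A (B ∷ X) with highest f B X
  ... | M , M∈ , M-max with ℤ.≤-total (f A) (f M)
  ... | inj₁ A≤M = M , there M∈ , λ { (here refl) → A≤M ; (there p) → M-max p }
  ... | inj₂ M≤A = A , here refl , λ { (here refl) → ℤ.≤-refl ; (there p) → ℤ.≤-trans (M-max p) M≤A }

  Below Above : ℤ → List Box → Set
  Below t X = ∀ {A} → A ∈ X → z A ℤ.≤ t
  Above t Y = ∀ {A} → A ∈ Y → t ℤ.< z A

  -- The lower parts of two identified stacks correspond, since they have equally many blocks.
  module _ {X X′ Y Y′ t t′}
           (X≤t : Below t X) (Y>t : Above t Y) (X′≤t′ : Below t′ X′) (Y′>t′ : Above t′ Y′)
           (uX : Unique X) (uX′ : Unique X′) (len : length X ≡ length X′)
           k v (stacks : map (move k v) (X ++ Y) ∼[ set ] X′ ++ Y′) where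

    private
      c : ℤ
      c = proj₂ (proj₂ v)

      z≡ : ∀ A → z (move k v A) ≡ z A ℤ.+ c
      z≡ = z-move k v

      uMX : Unique (map (move k v) X)
      uMX = map⁺ (move-injective k v) uX

      lenM : length (map (move k v) X) ≡ length X′
      lenM = trans (length-map (move k v) X) len

      below-above : ∀ {A t} → z A ℤ.≤ t → t ℤ.< z A → ∀ {P : Set} → P
      below-above p q = contradiction p (ℤ.<⇒≱ q)

      low : t ℤ.+ c ℤ.≤ t′ → map (move k v) X ⊆ X′
      low t+c≤t′ A∈ with ∈-map⁻ (move k v) A∈
      ... | A , A∈X , refl with ∈-++⁻ X′ (image∈ k v {X ++ Y} stacks (∈-++⁺ˡ A∈X))
      ... | inj₁ p = p
      ... | inj₂ p = below-above {move k v A} (subst (ℤ._≤ t′) (sym (z≡ A)) (ℤ.≤-trans (ℤ.+-monoˡ-≤ c (X≤t A∈X)) t+c≤t′)) (Y′>t′ p)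

      high : t′ ℤ.≤ t ℤ.+ c → X′ ⊆ map (move k v) X
      high t′≤t+c A∈ with preimage k v {X ++ Y} stacks (∈-++⁺ˡ A∈)
      ... | A , A∈X++Y , refl with ∈-++⁻ X A∈X++Y
      ... | inj₁ p = ∈-map⁺ (move k v) p
      ... | inj₂ p = below-above {move k v A} (X′≤t′ A∈)
        (subst (t′ ℤ.<_) (sym (z≡ A)) (ℤ.≤-<-trans t′≤t+c (ℤ.+-monoˡ-< c (Y>t p))))

    -- The move raises every block by c. If t + c ≤ t′, the image of X is too low to meet Y′;
    -- otherwise X′ is too low to meet the image of Y. Either way one inclusion holds, and equal
    -- sizes give the other.
    lower∼ : map (move k v) X ∼[ set ] X′
    lower∼ with ℤ.≤-total (t ℤ.+ c) t′
    ... | inj₁ le = ⊆-antisym (low le) (Unique-⊆-full _≟ᴮ_ uMX (low le) (ℕ.≤-reflexive (sym lenM)))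
    ... | inj₂ ge = ⊆-antisym (Unique-⊆-full _≟ᴮ_ uX′ (high ge) (ℕ.≤-reflexive lenM)) (high ge)

    upper∼ : map (move k v) Y ∼[ set ] Y′
    upper∼ = ⊆-antisym to from
      where
      to : map (move k v) Y ⊆ Y′
      to A∈ with ∈-map⁻ (move k v) A∈
      ... | A , A∈Y , refl with ∈-++⁻ X′ (image∈ k v {X ++ Y} stacks (∈-++⁺ʳ X A∈Y))
      ... | inj₂ p = p
      ... | inj₁ p with preimage k v {X} lower∼ p
      ... | B , B∈X , eq with move-injective k v {A} {B} eq
      ... | refl = below-above {A} (X≤t B∈X) (Y>t A∈Y)
      from : Y′ ⊆ map (move k v) Y
      from A∈ with preimage k v {X ++ Y} stacks (∈-++⁺ʳ X′ A∈)
      ... | A , A∈X++Y , refl with ∈-++⁻ X A∈X++Y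
      ... | inj₂ p = ∈-map⁺ (move k v) p
      ... | inj₁ p = below-above {move k v A} (X′≤t′ (image∈ k v {X} lower∼ p)) (Y′>t′ A∈)

  module _ (b w : ℕ) .{{_ : NonZero b}} .{{_ : NonZero w}} where

    module _ {m n} (X : Building b w (suc m)) (Y : Building b w (suc n)) where

      private
        extreme : ∀ (f : Box → ℤ) {n} (X : Building b w (suc n)) →
          ∃[ M ] (M ∈ blocks X × (∀ {B} → B ∈ blocks X → f B ℤ.≤ f M))
        extreme f X with blocks X | size X
        ... | A ∷ X′ | _ = highest f A X′

        top    = extreme z X
        bottom = extreme (λ A → ℤ.- z A) Y
        P      = proj₁ top
        Q      = proj₁ bottom
        P∈X    = proj₁ (proj₂ top)

        -- Puts a lowest block Q of Y directly on a highest block P of X with their corners aligned,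
        -- so that they overlap whatever their orientations.
        lift : Vector
        lift = x P ℤ.- x Q , y P ℤ.- y Q , z P ℤ.+ 1ℤ ℤ.- z Q

        lemma : ∀ p q → p ℤ.+ (q ℤ.- p) ≡ q
        lemma = ℤ-solve-∀

      raised : Building b w (suc n)
      raised = translated b w Y lift

      level : ℤ
      level = z P

      private
        Q⁺ : Box
        Q⁺ = translate lift Q

        Q⁺∈ : Q⁺ ∈ blocks raised
        Q⁺∈ = ∈-map⁺ (translate lift) (proj₁ (proj₂ bottom))

        P-Q⁺ : Attached P Q⁺
        P-Q⁺ = inj₁ (lemma (z Q) (z P ℤ.+ 1ℤ)) ,
            meet (x P) (x Q) (proj₁ dimsP) (proj₁ dimsQ) , meet (y P) (y Q) (proj₂ dimsP) (proj₂ dimsQ)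
          where
          dimsP = dims-pos b w {P} (isBlock b w X P∈X)
          dimsQ = dims-pos b w {Q} (isBlock b w Y (proj₁ (proj₂ bottom)))
          meet : ∀ p q {m n} → 0 ℕ.< m → 0 ℕ.< n → IntervalsMeet p m (q ℤ.+ (p ℤ.- q)) n
          meet p q 0<m 0<n = subst (λ r → IntervalsMeet p _ r _) (sym (lemma q p)) (IntervalsMeet-self p 0<m 0<n)

      lower-below : Below level (blocks X)
      lower-below = proj₂ (proj₂ top)

      raised-above : Above level (blocks raised)
      raised-above A∈ with ∈-map⁻ (translate lift) A∈
      ... | A , A∈Y , refl = ℤ.<-≤-trans (p<p+n (z P) {1} (s≤s z≤n))
            (subst (ℤ._≤ z A ℤ.+ (z P ℤ.+ 1ℤ ℤ.- z Q)) (lemma (z Q) (z P ℤ.+ 1ℤ))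
          (ℤ.+-monoˡ-≤ (z P ℤ.+ 1ℤ ℤ.- z Q) (ℤ.neg-cancel-≤ (proj₂ (proj₂ bottom) A∈Y))))

      stack : Building b w (suc m ℕ.+ suc n)
      stack = record
        { blocks     = blocks X ++ blocks raised
        ; size       = trans (length-++ (blocks X)) (cong₂ ℕ._+_ (size X) (size raised))
        ; areBlocks  = ++⁺ (areBlocks X) (areBlocks raised)
        ; disjoint   = AllPairs.++⁺ (disjoint X) (disjoint raised) (All.tabulate λ {A} p → All.tabulate λ {B} q →
                         z<⇒disjoint {A} {B} (ℤ.≤-<-trans (lower-below p) (raised-above q)))
        ; contiguous = Rooted⇒Contiguous {r = Q⁺} reach
        }
        where
        reach : Rooted (blocks X ++ blocks raised) Q⁺
        reach p with ∈-++⁻ (blocks X) p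
        ... | inj₁ q = Adj-mono ∈-++⁺ˡ (contiguous X q P∈X) ◅◅ ((∈-++⁺ˡ P∈X , ∈-++⁺ʳ (blocks X) Q⁺∈ , P-Q⁺) ◅ Star.ε)
        ... | inj₂ q = Adj-mono (∈-++⁺ʳ (blocks X)) (contiguous raised q Q⁺∈)

      raised≈ : Identified (blocks Y) (blocks raised)
      raised≈ = 0 , lift , ∼.refl

    -- `raised` depends on both arguments, but it differs from Y only by a translation, which
    -- identification absorbs.
    stack-injective : ∀ {m n} {X X′ : Building b w (suc m)} {Y Y′ : Building b w (suc n)} →
      Identified (blocks (stack X Y)) (blocks (stack X′ Y′)) →
      Identified (blocks X) (blocks X′) × Identified (blocks Y) (blocks Y′)
    stack-injective {m} {n} {X} {X′} {Y} {Y′} (k , v , eq) =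
      (k , v , lower∼ lo hi lo′ hi′ uX uX′ len k v eq) ,
      S.trans {Y} {raised X Y} {Y′} (raised≈ X Y)
        (S.trans {raised X Y} {raised X′ Y′} {Y′} (k , v , upper∼ lo hi lo′ hi′ uX uX′ len k v eq)
          (S.sym {Y′} {raised X′ Y′} (raised≈ X′ Y′)))
      where
      module S = Setoid (buildings b w (suc n))
      lo  = λ {A} → lower-below X Y {A}
      hi  = λ {A} → raised-above X Y {A}
      lo′ = λ {A} → lower-below X′ Y′ {A}
      hi′ = λ {A} → raised-above X′ Y′ {A}
      uX  = unique b w X
      uX′ = unique b w X′
      len = trans (size X) (sym (size X′))

    module _ (T : ℕ → ℕ) (T-card : ∀ n → HasCardinality (buildings b w n) (T n)) where

      module C n = Classes {buildings b w n} {T n} (T-card n)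

      T-super : ∀ m n → 1 ℕ.≤ m → 1 ℕ.≤ n → T m ℕ.* T n ℕ.≤ T (m ℕ.+ n)
      T-super (suc m) (suc n) _ _ = product-≤ stacked λ { {i , j} {i′ , j′} eq →
        let X≈ , Y≈ = stack-injective {X = C.rep _ i} {C.rep _ i′} {C.rep _ j} {C.rep _ j′}
                        (C.class-injective _ {stack (C.rep _ i) (C.rep _ j)} {stack (C.rep _ i′) (C.rep _ j′)} eq)
        in cong₂ _,_ (C.rep-injective _ X≈) (C.rep-injective _ Y≈) }
        where
        stacked : Fin (T (suc m)) × Fin (T (suc n)) → Fin (T (suc m ℕ.+ suc n))
        stacked (i , j) = C.class _ (stack (C.rep _ i) (C.rep _ j))

      T-pos : ∀ n → 1 ℕ.≤ n → 1 ℕ.≤ T n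
      T-pos 1 _ = inhabited (C.class 1 (single b w (box 0ℤ 0ℤ 0ℤ b w) (inj₁ (refl , refl))))
        where
        inhabited : ∀ {k} → Fin k → 1 ℕ.≤ k
        inhabited {suc k} _ = s≤s z≤n
      T-pos (suc n@(suc _)) _ = ℕ.≤-trans (ℕ.*-mono-≤ (T-pos 1 (s≤s z≤n)) (T-pos n (s≤s z≤n))) (T-super 1 n (s≤s z≤n) (s≤s z≤n))

-- Splitting a building into two that share a block

module Splitting where

  open Rates using (window-maximum)
  open import Data.Nat.Base using (_+_; _*_; _^_; _∸_; _≤_; _<_; _⊓_; pred)

  -- Lookup with a dummy box beyond the end. Names of blocks are plain numbers, so that codes can be
  -- compared before their lists are known to be equal.
  at : List Box → ℕ → Box
  at []      _       = box 0ℤ 0ℤ 0ℤ 0 0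
  at (A ∷ X) zero    = A
  at (A ∷ X) (suc p) = at X p

  ∈⇒at : ∀ {A X} → A ∈ X → ∃[ p ] (p < length X × at X p ≡ A)
  ∈⇒at (here refl) = 0 , s≤s z≤n , refl
  ∈⇒at (there A∈X) = let p , p< , eq = ∈⇒at A∈X in suc p , s≤s p< , eq

  -- The rotation k together with the translation that takes box q of J to the corner of box p of I.
  -- The shared box then occurs twice, which is harmless because lists are compared as sets.
  glue : List Box → List Box → (p q k : ℕ) → List Box
  glue I J p q k = I ++ map (align k (at J q) (at I p)) J

  -- The position of J relative to I is determined by the rotation, modulo 4, between them and the
  -- names in I and in J of a shared box P.
  glued : ∀ {X L R I J P} → L ⊆ X → R ⊆ X → X ⊆ L ++ R → P ∈ L → P ∈ R → Identified L I → Identified J R →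
    ∃[ p ] ∃[ q ] ∃[ k ] (p < length I × q < length J × k < 4 × Identified X (glue I J p q k))
  glued {X} {L} {R} {I} {J} {P} L⊆X R⊆X X⊆L++R P∈L P∈R (j , u , L∼I) (k , v , J∼R) = named (preimage k v {J} J∼R P∈R)
    where
    named : ∃[ Q ] (Q ∈ J × P ≡ move k v Q) →
      ∃[ p ] ∃[ q ] ∃[ k ] (p < length I × q < length J × k < 4 × Identified X (glue I J p q k))
    named (Q , Q∈J , refl) = p , q , (j + k) % 4 , p< , q< , m%n<n (j + k) 4 , j , u , ⊆-antisym to from
      where
      inI = ∈⇒at (image∈ j u {L} L∼I P∈L)
      inJ = ∈⇒at Q∈J
      p = proj₁ inI
      q = proj₁ inJ
      p< = proj₁ (proj₂ inI)
      q< = proj₁ (proj₂ inJ)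
      place : Box → Box
      place = align ((j + k) % 4) (at J q) (at I p)
      compose : ∀ C → move j u (move k v C) ≡ place C
      compose C = trans (move-∘ j u k v C) (trans (move≗align (j + k) _ Q C)
        (cong₂ (λ A B → align ((j + k) % 4) A B C) (sym (proj₂ (proj₂ inJ)))
          (trans (sym (move-∘ j u k v Q)) (sym (proj₂ (proj₂ inI))))))
      to : map (move j u) X ⊆ I ++ map place J
      to A∈ with ∈-map⁻ (move j u) A∈
      ... | A , A∈X , refl with ∈-++⁻ L (X⊆L++R A∈X)
      ... | inj₁ A∈L = ∈-++⁺ˡ (image∈ j u {L} L∼I A∈L)
      ... | inj₂ A∈R with preimage k v {J} J∼R A∈R
      ... | C , C∈J , refl = ∈-++⁺ʳ I (subst (_∈ map place J) (sym (compose C)) (∈-map⁺ place C∈J))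
      from : I ++ map place J ⊆ map (move j u) X
      from B∈ with ∈-++⁻ I B∈
      ... | inj₁ B∈I with preimage j u {L} L∼I B∈I
      ... | A , A∈L , refl = ∈-map⁺ (move j u) (L⊆X A∈L)
      from B∈ | inj₂ B∈J with ∈-map⁻ place B∈J
      ... | C , C∈J , refl = subst (_∈ map (move j u) X) (compose C) (∈-map⁺ (move j u) (R⊆X (image∈ k v {J} J∼R C∈J)))

  -- D will be a glued list, not a `Building`, so symmetry and transitivity in the setoid
  -- `buildings` do not apply to it.
  Identified-cospan : ∀ {X X′ D} → Identified X D → Identified X′ D → Identified X X′
  Identified-cospan {X} {X′} {D} (k , v , X∼D) (k′ , v′ , X′∼D) = j + k , turnᵛ j v ⊕ u , ⊆-antisym to from
    where
    j = k′ * 3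
    u = turnᵛ j (negᵛ v′)
    back : Box → Box
    back = move (j + k) (turnᵛ j v ⊕ u)
    back≡ : ∀ {A A′} → move k v A ≡ move k′ v′ A′ → back A ≡ A′
    back≡ {A} {A′} eq = trans (sym (move-∘ j u k v A)) (trans (cong (move j u) eq) (move-inverse k′ v′ A′))
    to : map back X ⊆ X′
    to A∈ with ∈-map⁻ back A∈
    ... | A , A∈X , refl with preimage k′ v′ {X′} X′∼D (image∈ k v {X} X∼D A∈X)
    ... | A′ , A′∈X′ , eq = subst (_∈ X′) (sym (back≡ {A} {A′} eq)) A′∈X′
    from : X′ ⊆ map back X
    from {A′} A′∈X′ with preimage k v {X} X∼D (image∈ k′ v′ {X′} X′∼D A′∈X′)
    ... | A , A∈X , eq = subst (_∈ map back X) (back≡ {A} {A′} (sym eq)) (∈-map⁺ back A∈X)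

  module _ (b w : ℕ) .{{_ : NonZero b}} .{{_ : NonZero w}}
           (T : ℕ → ℕ) (T-card : ∀ n → HasCardinality (buildings b w n) (T n)) where

    private
      module C n = Classes {buildings b w n} {T n} (T-card n)

    module _ (N : ℕ) (2≤N : 2 ≤ N) where

      -- The two parts have suc m and suc r blocks, since both contain the shared block.
      record Code {n} (X : Building b w n) : Set where
        field
          m r     : ℕ
          total   : suc (m + r) ≡ n
          lower   : N ≤ suc m
          upper   : suc m < 2 * N
          i       : Fin (T (suc m))
          j       : Fin (T (suc r))
          p q k   : ℕ
          p<n     : p < n
          q<n     : q < n
          k<4     : k < 4
          decodes : Identified (blocks X) (glue (blocks (C.rep (suc m) i)) (blocks (C.rep (suc r) j)) p q k)

      -- Each part of the cut is replaced by the representative of its class. It is then known only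
      -- up to a move, which is why `glued` must recover the relative position.
      code : ∀ {n} → N ≤ n → (X : Building b w n) → Code X
      code {zero}  N≤0 X = contradiction (ℕ.≤-trans 2≤N N≤0) λ ()
      code {suc n} N≤n X with grown b w X refl
      ... | Y , g , uY , Y⊆X , len = record
        { m = length left ; r = length right ; total = total ; lower = left-lower ; upper = left-upper
        ; i = C.class _ L ; j = C.class _ R
        ; p = p ; q = q ; k = k
        ; p<n = ℕ.<-≤-trans p< (ℕ.≤-trans (ℕ.≤-reflexive (size (C.rep _ (C.class _ L))))
                  (subst (suc (length left) ≤_) total (s≤s (ℕ.m≤m+n _ _))))
        ; q<n = ℕ.<-≤-trans q< (ℕ.≤-trans (ℕ.≤-reflexive (size (C.rep _ (C.class _ R))))
                  (subst (suc (length right) ≤_) total (s≤s (ℕ.m≤n+m _ _))))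
        ; k<4 = k<4 ; decodes = decodes
        }
        where
        open Split (split-grown N 2≤N g (subst (N ≤_) (sym len) N≤n))
        total : suc (length left + length right) ≡ suc n
        total = trans (cong suc (sym (length-++ left))) (trans (↭-length perm) len)
        u = Unique-resp-↭ (↭-sym perm) uY
        u′ = Unique-resp-↭ (↭-sym (shift shared left right)) u
        left⊆ : shared ∷ left ⊆ blocks X
        left⊆ = Y⊆X ∘ ∈-resp-↭ perm ∘ ∈-++⁺ˡ
        right⊆ : shared ∷ right ⊆ blocks X
        right⊆ = Y⊆X ∘ ∈-resp-↭ perm ∘ ∈-resp-↭ (shift shared left right) ∘ ∈-++⁺ʳ left
        L : Building b w (suc (length left))
        L = subBuilding b w X left⊆ (proj₁ (Unique-++⁻ (shared ∷ left) u)) left-cont refl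
        R : Building b w (suc (length right))
        R = subBuilding b w X right⊆ (proj₂ (Unique-++⁻ left u′)) right-cont refl
        X⊆Y : blocks X ⊆ Y
        X⊆Y = Unique-⊆-full _≟ᴮ_ uY Y⊆X (ℕ.≤-reflexive (trans (size X) (sym len)))
        X⊆L++R : blocks X ⊆ (shared ∷ left) ++ (shared ∷ right)
        X⊆L++R A∈X with ∈-++⁻ (shared ∷ left) (∈-resp-↭ (↭-sym perm) (X⊆Y A∈X))
        ... | inj₁ A∈ = ∈-++⁺ˡ A∈
        ... | inj₂ A∈ = ∈-++⁺ʳ (shared ∷ left) (there A∈)
        gluing = glued left⊆ right⊆ X⊆L++R (here refl) (here refl)
          (Setoid.sym (buildings b w _) {C.rep _ (C.class _ L)} {L} (C.rep-class _ L)) (C.rep-class _ R)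
        p = proj₁ gluing
        q = proj₁ (proj₂ gluing)
        k = proj₁ (proj₂ (proj₂ gluing))
        p< = proj₁ (proj₂ (proj₂ (proj₂ gluing)))
        q< = proj₁ (proj₂ (proj₂ (proj₂ (proj₂ gluing))))
        k<4 = proj₁ (proj₂ (proj₂ (proj₂ (proj₂ (proj₂ gluing)))))
        decodes = proj₂ (proj₂ (proj₂ (proj₂ (proj₂ (proj₂ gluing)))))

      -- The equation between the sizes m forces r to agree, and only then do the class indices have
      -- the same types; until then they are compared through `toℕ`.
      code-injective : ∀ {n} {X X′ : Building b w n} (c : Code X) (c′ : Code X′) →
        Code.k c ≡ Code.k c′ → Code.p c ≡ Code.p c′ → Code.q c ≡ Code.q c′ → Code.m c ≡ Code.m c′ →
        toℕ (pair (Code.i c , Code.j c)) ≡ toℕ (pair (Code.i c′ , Code.j c′)) →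
        Identified (blocks X) (blocks X′)
      code-injective record { m = m ; r = r ; total = total ; i = i ; j = j ; decodes = d }
                     record { r = r′ ; total = total′ ; i = i′ ; j = j′ ; decodes = d′ } refl refl refl refl eq
        with ℕ.+-cancelˡ-≡ m r r′ (ℕ.suc-injective (trans total (sym total′)))
      ... | refl with pair-injective _ _ {i , j} {i′ , j′} (toℕ-injective eq)
      ... | refl = Identified-cospan d d′

      -- The factors count the rotation, the two names of the shared block, the size m, and the pair
      -- of classes. P bounds the number of pairs for every admissible size, so that all pairs embed
      -- in one `Fin P`.
      T-code : ∀ n P → N ≤ n → (∀ m r → suc (m + r) ≡ n → N ≤ suc m → suc m < 2 * N → T (suc m) * T (suc r) ≤ P) →
        T n ≤ 4 * (n * (n * (n * P)))
      T-code n P N≤n bound = injective⇒≤ {f = encode} λ {s} {t} eq →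
        let k≡ , eq₁ = ,-injective (pair-injective 4 (n * (n * (n * P))) eq)
            p≡ , eq₂ = ,-injective (pair-injective n (n * (n * P)) eq₁)
            q≡ , eq₃ = ,-injective (pair-injective n (n * P) eq₂)
            m≡ , c≡  = ,-injective (pair-injective n P eq₃)
        in C.rep-injective n (code-injective (c s) (c t) 
             (fromℕ<-injective _ _ (k<4 (c s)) (k<4 (c t)) k≡) (fromℕ<-injective _ _ (p<n (c s)) (p<n (c t)) p≡)
             (fromℕ<-injective _ _ (q<n (c s)) (q<n (c t)) q≡) (fromℕ<-injective _ _ (m<n s) (m<n t) m≡)
             (inject≤-inj (fits s) (fits t) c≡))
        where
        open Code
        c : (s : Fin (T n)) → Code (C.rep n s)
        c s = code N≤n (C.rep n s)
        m<n : ∀ s → m (c s) < n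
        m<n s = subst (m (c s) <_) (total (c s)) (s≤s (ℕ.m≤m+n _ _))
        fits : ∀ s → T (suc (m (c s))) * T (suc (r (c s))) ≤ P
        fits s = bound (m (c s)) (r (c s)) (total (c s)) (lower (c s)) (upper (c s))
        encode : Fin (T n) → Fin (4 * (n * (n * (n * P))))
        encode s = pair (fromℕ< (k<4 (c s)) , pair (fromℕ< (p<n (c s)) , pair (fromℕ< (q<n (c s)) ,
          pair (fromℕ< (m<n s) , inject≤ (pair (i (c s) , j (c s))) (fits s)))))
        inject≤-inj : ∀ {a b n} {s : Fin a} {t : Fin b} (a≤n : a ≤ n) (b≤n : b ≤ n) →
          inject≤ s a≤n ≡ inject≤ t b≤n → toℕ s ≡ toℕ t
        inject≤-inj {s = s} {t} a≤n b≤n eq = trans (sym (toℕ-inject≤ s a≤n)) (trans (cong toℕ eq) (toℕ-inject≤ t b≤n))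

    -- The size of the cut varies with the building, so m is taken where the product
    -- `T m * T (suc n ∸ m)` is largest among the admissible sizes; its value serves as P in
    -- `T-code`.
    T-split : ∀ N n → 2 ≤ N → N ≤ n → ∃[ m ] ∃[ l ] (m + l ≡ suc n × N ≤ m × m < 2 * N × m ≤ n ×
                T n ≤ 4 * n ^ 3 * (T m * T l))
    T-split N n 2≤N N≤n = m , suc n ∸ m , ℕ.m+[n∸m]≡n (ℕ.m≤n⇒m≤1+n m≤n) , N≤m , m<2N , m≤n ,
      ℕ.≤-trans (T-code N 2≤N n (product m) N≤n bound) (ℕ.≤-reflexive (lemma n (product m)))
      where
      product : ℕ → ℕ
      product m = T m * T (suc n ∸ m)
      0<N = ℕ.≤-trans (s≤s z≤n) 2≤N
      instance
        2N≢0 : NonZero (2 * N)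
        2N≢0 = ℕ.>-nonZero (ℕ.≤-trans 0<N (ℕ.m≤m+n N _))
      -- The window [N, u] expresses N ≤ m < 2 N together with m ≤ n; the predecessor accounts for
      -- the strict inequality.
      u = n ⊓ pred (2 * N)
      N≤u : N ≤ u
      N≤u = ℕ.⊓-glb N≤n (ℕ.<⇒≤pred (ℕ.m<m+n N (subst (0 <_) (sym (ℕ.+-identityʳ N)) 0<N)))
      best = window-maximum (λ m l → product m ≤ product l) (λ m l → ℕ.≤-total (product m) (product l)) N
               (λ _ → ℕ.≤-trans) (u ∸ N)
      m = proj₁ best
      N≤m = proj₁ (proj₂ best)
      m≤u : m ≤ u
      m≤u = subst (m ≤_) (ℕ.m∸n+n≡m N≤u) (proj₁ (proj₂ (proj₂ best)))
      m≤n = ℕ.≤-trans m≤u (ℕ.m⊓n≤m n _)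
      m<2N = ℕ.m≤pred[n]⇒suc[m]≤n {2 * N} (ℕ.≤-trans m≤u (ℕ.m⊓n≤n n _))
      bound : ∀ m′ r → suc (m′ + r) ≡ n → N ≤ suc m′ → suc m′ < 2 * N → T (suc m′) * T (suc r) ≤ product m
      bound m′ r refl N≤m′ m′<2N = subst (λ l → T (suc m′) * T l ≤ product m)
        (trans (cong (_∸ m′) (sym (ℕ.+-suc m′ r))) (ℕ.m+n∸m≡n m′ (suc r)))
        (proj₂ (proj₂ (proj₂ best)) (suc m′) N≤m′ (subst (suc m′ ≤_) (sym (ℕ.m∸n+n≡m N≤u))
          (ℕ.⊓-glb (s≤s (ℕ.m≤m+n m′ r)) (ℕ.<⇒≤pred m′<2N))))
      lemma : ∀ n P → 4 * (n * (n * (n * P))) ≡ 4 * (n * (n * (n * 1))) * P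
      lemma = solve-∀

theorem2p9 : (b w : ℕ) .{{_ : NonZero b}} .{{_ : NonZero w}} →
    Σ[ T ∈ (ℕ → ℕ) ]
    ((∀ n → HasCardinality (buildings b w n) (T n)) ×
    Σ[ s ∈ ℝ ] ((λ n → log (T n) ÷ n) ⟶ s))
theorem2p9 b w = T , T-card , growth-rate T positive
    (effective-rates T positive (T-super b w T T-card) (T-split b w T T-card))
  where
  open Limits using (growth-rate)
  open Rates using (effective-rates)
  open Splitting using (T-split)
  open Stacking using (T-super; T-pos)
  T : ℕ → ℕ
  T n = proj₁ (finite b w n)
  T-card : ∀ n → HasCardinality (buildings b w n) (T n)
  T-card n = proj₂ (finite b w n)
  positive : ∀ n → 1 ℕ.≤ n → 1 ℕ.≤ T n
  positive = T-pos b w T T-card
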